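{- Let $a$ and $b$ be positive integers with $\gcd(a,b)=1$, and let $\lambda\in\mathbb{C}$ with $\lambda\neq 0$, $\lambda^a\neq 1$ and $\lambda^b\neq 1$. Then $$ S_1^{(\lambda)}(a,b)=\frac{1}{(\lambda-1)^2}+\frac{a b\, \lambda^{a b-1}}{(\lambda^a-1)(\lambda^b-1)}-\frac{(\lambda^{a b}-1)\bigl((a+b)\lambda^{a+b}-a \lambda^a-b \lambda^b\bigr)}{\lambda(\lambda^a-1)^2(\lambda^b-1)^2}. $$
   Context: For coprime positive integers $a,b$, $\mathrm{NR}(a,b)$ denotes the (finite) set of all nonnegative integers $n$ that cannot be expressed in the form $n=ax+by$ with $x,y$ nonnegative integers. (Since $0$ is representable, all elements are positive.) For a nonnegative integer $m$ and $\lambda\neq 0$, $$S_m^{(\lambda)}(a,b):=\sum_{n\in \mathrm{NR}(a,b)}\lambda^{n-1}n^m.$$ -}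

module Defs where

open import Level using (0ℓ)
open import Algebra.Apartness.Bundles using (HeytingField)
import Algebra.Apartness.Properties.HeytingCommutativeRing as HeytingProperties
import Algebra.Definitions.RawSemiring as RawSemiringDefinitions
import Algebra.Properties.Ring as RingProperties
open import Algebra.Bundles using (CommutativeRing; Semiring)
import Algebra.Solver.Ring.NaturalCoefficients.Default as NaturalCoefficients
open import Algebra.Structures using (IsCommutativeRing)
import Algebra.Definitions as AlgebraDefinitions
open import Data.Empty using (⊥-elim)
open import Data.List.Base using (List; foldr; map; filter; upTo)
open import Data.List.Membership.Propositional using (_∈_)
open import Data.List.Membership.Propositional.Properties using (∈-filter⁺; ∈-filter⁻; ∈-upTo⁺)
open import Data.List.Relation.Unary.Unique.Propositional using (Unique)
import Data.List.Relation.Unary.Unique.Propositional.Properties as Unique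
open import Data.Nat.Base as ℕ using (ℕ; zero; suc; _∸_)
import Data.Nat.DivMod as ℕ
open import Data.Nat.GCD using (gcd; GCD; gcd-GCD; module Bézout)
import Data.Nat.Properties as ℕ
open import Data.Product.Base using (∃; ∃-syntax; _×_; _,_; proj₁; proj₂)
open import Data.Rational.Base as ℚ using (ℚ; 0ℚ; 1ℚ; ½)
import Data.Rational.Properties as ℚ
import Data.Rational.Solver as ℚ-Solver
open import Data.Sum.Base using (_⊎_; inj₁; inj₂; [_,_]′)
open import Function.Base using (_∘_)
open import Function.Bundles using (_⇔_; mk⇔)
open import Relation.Binary.Definitions using (Irreflexive; Symmetric; Cotransitive; Tight)
open import Relation.Binary.PropositionalEquality
  using (_≡_; _≢_; refl; sym; trans; cong; cong₂; subst; subst₂; module ≡-Reasoning)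
import Relation.Binary.Reasoning.Setoid as SetoidReasoning
open import Relation.Nullary using (¬_; Dec; yes; no; ¬?; contradiction)
open import Relation.Nullary.Decidable using (map′)

-- The real numbers: Cauchy sequences of rationals, identified when their
-- difference tends to 0.  As there are no quotient types, the identification is
-- a setoid equality.  x # y is the constructive reading of x ≠ y: the distance
-- from x to y is bounded below by a positive rational.

module Real where

  open import Data.Rational.Base using (_+_; _*_; _-_; -_; _<_; _≤_; ∣_∣)

  private
    module Rational where

      open ℚ-Solver.+-*-Solver

      0<½ : 0ℚ < ½
      0<½ = ℚ.positive⁻¹ ½

      0<1 : 0ℚ < 1ℚ
      0<1 = ℚ.positive⁻¹ 1ℚ

      0<* : ∀ {p q} → 0ℚ < p → 0ℚ < q → 0ℚ < p * q
      0<* {p} {q} 0<p 0<q =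
        ℚ.positive⁻¹ (p * q) {{ℚ.pos*pos⇒pos p {{ℚ.positive 0<p}} q {{ℚ.positive 0<q}}}}

      halves : ∀ ε → ½ * ε + ½ * ε ≡ ε
      halves ε = trans (sym (ℚ.*-distribʳ-+ ε ½ ½)) (ℚ.*-identityˡ ε)

      1/_⟨_⟩ : ∀ p → 0ℚ < p → ℚ
      1/ p ⟨ 0<p ⟩ = (ℚ.1/ p) {{ℚ.>-nonZero 0<p}}

      0<1/ : ∀ {p} (0<p : 0ℚ < p) → 0ℚ < 1/ p ⟨ 0<p ⟩
      0<1/ {p} 0<p = ℚ.positive⁻¹ _ {{ℚ.1/pos⇒pos p {{ℚ.positive 0<p}}}}

      *-1/ : ∀ {p} (0<p : 0ℚ < p) → p * 1/ p ⟨ 0<p ⟩ ≡ 1ℚ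
      *-1/ {p} 0<p = ℚ.*-inverseʳ p {{ℚ.>-nonZero 0<p}}

      ∣+∣< : ∀ {p q a b} → ∣ p ∣ < a → ∣ q ∣ < b → ∣ p + q ∣ < a + b
      ∣+∣< {p} {q} p<a q<b = ℚ.≤-<-trans (ℚ.∣p+q∣≤∣p∣+∣q∣ p q) (ℚ.+-mono-< p<a q<b)

      *-mono : ∀ {p q a b} → 0ℚ ≤ q → 0ℚ ≤ a → p ≤ a → q ≤ b → p * q ≤ a * b
      *-mono {p} {q} {a} {b} 0≤q 0≤a p≤a q≤b = ℚ.≤-trans
        (ℚ.*-monoʳ-≤-nonNeg q {{ℚ.nonNegative 0≤q}} p≤a)
        (ℚ.*-monoˡ-≤-nonNeg a {{ℚ.nonNegative 0≤a}} q≤b)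

      ∣*∣≤ : ∀ {p q a b} → 0ℚ ≤ a → ∣ p ∣ ≤ a → ∣ q ∣ ≤ b → ∣ p * q ∣ ≤ a * b
      ∣*∣≤ {p} {q} 0≤a p≤a q≤b =
        subst (_≤ _) (sym (ℚ.∣p*q∣≡∣p∣*∣q∣ p q)) (*-mono (ℚ.0≤∣p∣ q) 0≤a p≤a q≤b)

      ∣*∣< : ∀ {p q a ε} (0<a : 0ℚ < a) → ∣ p ∣ ≤ a → ∣ q ∣ < 1/ a ⟨ 0<a ⟩ * ε → ∣ p * q ∣ < ε
      ∣*∣< {p} {q} {a} {ε} 0<a p≤a q<ε/a = ℚ.≤-<-trans
        (∣*∣≤ {p} {q} (ℚ.<⇒≤ 0<a) p≤a ℚ.≤-refl)
        (subst (a * ∣ q ∣ <_) a[ε/a]≡ε (ℚ.*-monoʳ-<-pos a {{ℚ.positive 0<a}} q<ε/a))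
        where
        a[ε/a]≡ε : a * (1/ a ⟨ 0<a ⟩ * ε) ≡ ε
        a[ε/a]≡ε = trans (sym (ℚ.*-assoc a _ ε))
                    (trans (cong (_* ε) (*-1/ 0<a)) (ℚ.*-identityˡ ε))

      ∣p-q∣≡∣q-p∣ : ∀ p q → ∣ p - q ∣ ≡ ∣ q - p ∣
      ∣p-q∣≡∣q-p∣ p q = trans (cong ∣_∣ p-q≡-[q-p]) (ℚ.∣-p∣≡∣p∣ (q - p))
        where
        p-q≡-[q-p] : p - q ≡ - (q - p)
        p-q≡-[q-p] = solve 2 (λ p q → p :- q := :- (q :- p)) refl p q

      -- If δ ≤ ∣ p ∣ and q is closer than ½ δ to p, then ½ δ ≤ ∣ q ∣.
      remainder : ∀ {δ} r p q → r ≡ p + q → δ ≤ ∣ r ∣ → ∣ p ∣ < ½ * δ → ½ * δ ≤ ∣ q ∣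
      remainder {δ} r p q r≡p+q δ≤r p<½δ = ℚ.≮⇒≥ λ q<½δ →
        ℚ.<-irrefl refl (ℚ.≤-<-trans δ≤r
          (subst₂ _<_ (cong ∣_∣ (sym r≡p+q)) (halves δ) (∣+∣< {p} {q} p<½δ q<½δ)))

      recip : ℚ → ℚ
      recip p with p ℚ.≟ 0ℚ
      ... | yes _   = 0ℚ
      ... | no p≢0 = (ℚ.1/ p) {{ℚ.≢-nonZero p≢0}}

      *-recip : ∀ {p} → p ≢ 0ℚ → p * recip p ≡ 1ℚ
      *-recip {p} p≢0 with p ℚ.≟ 0ℚ
      ... | yes p≡0 = contradiction p≡0 p≢0
      ... | no p≢0′ = ℚ.*-inverseʳ p {{ℚ.≢-nonZero p≢0′}}

      bounded-away⇒≢0 : ∀ {δ p} → 0ℚ < δ → δ ≤ ∣ p ∣ → p ≢ 0ℚ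
      bounded-away⇒≢0 0<δ δ≤∣p∣ refl = ℚ.<-irrefl refl (ℚ.<-≤-trans 0<δ δ≤∣p∣)

      ∣recip∣≤ : ∀ {δ p} (0<δ : 0ℚ < δ) → δ ≤ ∣ p ∣ → ∣ recip p ∣ ≤ 1/ δ ⟨ 0<δ ⟩
      ∣recip∣≤ {δ} {p} 0<δ δ≤∣p∣ = ℚ.*-cancelˡ-≤-pos δ {{ℚ.positive 0<δ}} (begin
        δ * ∣ recip p ∣      ≤⟨ ℚ.*-monoʳ-≤-nonNeg ∣ recip p ∣ {{ℚ.∣-∣-nonNeg (recip p)}} δ≤∣p∣ ⟩
        ∣ p ∣ * ∣ recip p ∣  ≡⟨ ℚ.∣p*q∣≡∣p∣*∣q∣ p (recip p) ⟨
        ∣ p * recip p ∣      ≡⟨ cong ∣_∣ (*-recip (bounded-away⇒≢0 0<δ δ≤∣p∣)) ⟩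
        1ℚ                   ≡⟨ *-1/ 0<δ ⟨
        δ * 1/ δ ⟨ 0<δ ⟩     ∎)
        where open ℚ.≤-Reasoning

      product-difference : ∀ a b c d → a * b - c * d ≡ a * (b - d) + d * (a - c)
      product-difference =
        solve 4 (λ a b c d → a :* b :- c :* d := a :* (b :- d) :+ d :* (a :- c)) refl

      recip-difference : ∀ {p q} → p ≢ 0ℚ → q ≢ 0ℚ →
                         recip p - recip q ≡ (recip p * recip q) * (q - p)
      recip-difference {p} {q} p≢0 q≢0 = begin
        r - s                          ≡⟨ cong₂ _-_ (sym (ℚ.*-identityʳ r)) (sym (ℚ.*-identityʳ s)) ⟩
        r * 1ℚ - s * 1ℚ                ≡⟨ cong₂ (λ u v → r * u - s * v) (sym (*-recip q≢0)) (sym (*-recip p≢0)) ⟩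
        r * (q * s) - s * (p * r)      ≡⟨ solve 4 (λ r s p q → r :* (q :* s) :- s :* (p :* r)
                                                       := (r :* s) :* (q :- p)) refl r s p q ⟩
        (r * s) * (q - p)              ∎
        where
        open ≡-Reasoning
        r = recip p
        s = recip q

  open Rational

  IsCauchy : (ℕ → ℚ) → Set
  IsCauchy s = ∀ ε → 0ℚ < ε → ∃[ N ] ∀ m n → N ℕ.≤ m → N ℕ.≤ n → ∣ s m - s n ∣ < ε

  IsNull : (ℕ → ℚ) → Set
  IsNull s = ∀ ε → 0ℚ < ε → ∃[ N ] ∀ n → N ℕ.≤ n → ∣ s n ∣ < ε

  IsBoundedAway : (ℕ → ℚ) → Set
  IsBoundedAway s = ∃[ δ ] 0ℚ < δ × ∃[ N ] ∀ n → N ℕ.≤ n → δ ≤ ∣ s n ∣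

  record ℝ : Set where
    no-eta-equality
    constructor mkℝ
    field
      seq    : ℕ → ℚ
      cauchy : IsCauchy seq
  open ℝ

  infix 4 _≈_ _#_

  record _≈_ (x y : ℝ) : Set where
    constructor mk≈
    field null : IsNull (λ n → seq x n - seq y n)
  open _≈_

  record _#_ (x y : ℝ) : Set where
    constructor mk#
    field boundedAway : IsBoundedAway (λ n → seq x n - seq y n)
  open _#_

  private

    -- Cauchy sequences and null sequences are treated together, as double
    -- sequences tending to 0.
    Small : (ℕ → ℕ → ℚ) → Set
    Small f = ∀ ε → 0ℚ < ε → ∃[ N ] ∀ m n → N ℕ.≤ m → N ℕ.≤ n → ∣ f m n ∣ < ε

    Bounded : (ℕ → ℕ → ℚ) → Set
    Bounded f = ∃[ B ] 0ℚ < B × ∃[ N ] ∀ m n → N ℕ.≤ m → N ℕ.≤ n → ∣ f m n ∣ ≤ B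

    fromNull : ∀ {s} → IsNull s → Small (λ n _ → s n)
    fromNull s→0 ε 0<ε = let N , h = s→0 ε 0<ε in N , λ m _ N≤m _ → h m N≤m

    toNull : ∀ {s} → Small (λ n _ → s n) → IsNull s
    toNull s→0 ε 0<ε = let N , h = s→0 ε 0<ε in N , λ n N≤n → h n n N≤n N≤n

    upper-≤ˡ : ∀ M N {k} → M ℕ.⊔ N ℕ.≤ k → M ℕ.≤ k
    upper-≤ˡ M N = ℕ.≤-trans (ℕ.m≤m⊔n M N)

    upper-≤ʳ : ∀ M N {k} → M ℕ.⊔ N ℕ.≤ k → N ℕ.≤ k
    upper-≤ʳ M N = ℕ.≤-trans (ℕ.m≤n⊔m M N)

    small-cong : ∀ {f g} → (∃[ N ] ∀ m n → N ℕ.≤ m → N ℕ.≤ n → f m n ≡ g m n) → Small f → Small g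
    small-cong (M , f≡g) f→0 ε 0<ε = let N , h = f→0 ε 0<ε in
      M ℕ.⊔ N , λ m n p q → subst (λ t → ∣ t ∣ < ε)
        (f≡g m n (upper-≤ˡ M N p) (upper-≤ˡ M N q))
        (h m n (upper-≤ʳ M N p) (upper-≤ʳ M N q))

    small-≗ : ∀ {f g} → (∀ m n → f m n ≡ g m n) → Small f → Small g
    small-≗ f≡g = small-cong (0 , λ m n _ _ → f≡g m n)

    small-0 : Small (λ _ _ → 0ℚ)
    small-0 ε 0<ε = 0 , λ _ _ _ _ → 0<ε

    small-+ : ∀ {f g} → Small f → Small g → Small (λ m n → f m n + g m n)
    small-+ {f} {g} f→0 g→0 ε 0<ε =
      let M , hf = f→0 (½ * ε) (0<* 0<½ 0<ε)
          N , hg = g→0 (½ * ε) (0<* 0<½ 0<ε)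
      in M ℕ.⊔ N , λ m n p q → subst (∣ f m n + g m n ∣ <_) (halves ε)
           (∣+∣< {f m n} {g m n} (hf m n (upper-≤ˡ M N p) (upper-≤ˡ M N q))
                                 (hg m n (upper-≤ʳ M N p) (upper-≤ʳ M N q)))

    small-neg : ∀ {f} → Small f → Small (λ m n → - f m n)
    small-neg {f} f→0 ε 0<ε = let N , h = f→0 ε 0<ε in
      N , λ m n p q → subst (_< ε) (sym (ℚ.∣-p∣≡∣p∣ (f m n))) (h m n p q)

    small-* : ∀ {f g} → Bounded f → Small g → Small (λ m n → f m n * g m n)
    small-* {f} {g} (B , 0<B , M , hf) g→0 ε 0<ε =
      let N , hg = g→0 (1/ B ⟨ 0<B ⟩ * ε) (0<* (0<1/ 0<B) 0<ε)
      in M ℕ.⊔ N , λ m n p q →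
           ∣*∣< {f m n} {g m n} 0<B (hf m n (upper-≤ˡ M N p) (upper-≤ˡ M N q))
                                    (hg m n (upper-≤ʳ M N p) (upper-≤ʳ M N q))

    bounded-* : ∀ {f g} → Bounded f → Bounded g → Bounded (λ m n → f m n * g m n)
    bounded-* {f} {g} (A , 0<A , M , hf) (B , 0<B , N , hg) =
      A * B , 0<* 0<A 0<B , M ℕ.⊔ N , λ m n p q →
        ∣*∣≤ {f m n} {g m n} (ℚ.<⇒≤ 0<A) (hf m n (upper-≤ˡ M N p) (upper-≤ˡ M N q))
                                         (hg m n (upper-≤ʳ M N p) (upper-≤ʳ M N q))

    swap-bounded : ∀ {f} → Bounded f → Bounded (λ m n → f n m)
    swap-bounded (B , 0<B , N , h) = B , 0<B , N , λ m n p q → h n m q p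

    bounded : ∀ x → Bounded (λ m _ → seq x m)
    bounded x =
      let N , h = cauchy x 1ℚ 0<1
      in 1ℚ + ∣ s N ∣ , ℚ.+-mono-<-≤ 0<1 (ℚ.0≤∣p∣ (s N)) , N , λ m _ N≤m _ → begin
           ∣ s m ∣                  ≡⟨ cong ∣_∣ (split (s m) (s N)) ⟩
           ∣ (s m - s N) + s N ∣    ≤⟨ ℚ.∣p+q∣≤∣p∣+∣q∣ (s m - s N) (s N) ⟩
           ∣ s m - s N ∣ + ∣ s N ∣  ≤⟨ ℚ.+-monoˡ-≤ ∣ s N ∣ (ℚ.<⇒≤ (h m N N≤m ℕ.≤-refl)) ⟩
           1ℚ + ∣ s N ∣             ∎
      where
      s = seq x
      open ℚ.≤-Reasoning
      open ℚ-Solver.+-*-Solver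
      split : ∀ p q → p ≡ (p - q) + q
      split = solve 2 (λ p q → p := (p :- q) :+ q) refl

    recip-bounded : ∀ {s} → IsBoundedAway s → Bounded (λ m _ → recip (s m))
    recip-bounded (δ , 0<δ , N , h) =
      1/ δ ⟨ 0<δ ⟩ , 0<1/ 0<δ , N , λ m _ N≤m _ → ∣recip∣≤ 0<δ (h m N≤m)

  private
    open ℚ-Solver.+-*-Solver

    abstract
      const-cauchy : ∀ q → IsCauchy (λ _ → q)
      const-cauchy q = small-≗ (λ _ _ → sym (ℚ.+-inverseʳ q)) small-0

      +-cauchy : ∀ x y → IsCauchy (λ n → seq x n + seq y n)
      +-cauchy x y = small-≗ (λ m n → shuffle (seq x m) (seq x n) (seq y m) (seq y n))
                       (small-+ (cauchy x) (cauchy y))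
        where
        shuffle : ∀ a b c d → (a - b) + (c - d) ≡ (a + c) - (b + d)
        shuffle = solve 4 (λ a b c d → (a :- b) :+ (c :- d) := (a :+ c) :- (b :+ d)) refl

      neg-cauchy : ∀ x → IsCauchy (λ n → - seq x n)
      neg-cauchy x = small-≗ (λ m n → ℚ.neg-distrib-+ (seq x m) (- seq x n)) (small-neg (cauchy x))

      *-cauchy : ∀ x y → IsCauchy (λ n → seq x n * seq y n)
      *-cauchy x y =
        small-≗ (λ m n → sym (product-difference (seq x m) (seq y m) (seq x n) (seq y n)))
          (small-+ (small-* (bounded x) (cauchy y))
                   (small-* (swap-bounded (bounded y)) (cauchy x)))

      recip-cauchy : ∀ x → IsBoundedAway (seq x) → IsCauchy (λ n → recip (seq x n))
      recip-cauchy x x#0@(δ , 0<δ , N , h) = small-cong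
        (N , λ m n N≤m N≤n → sym (recip-difference (bounded-away⇒≢0 0<δ (h m N≤m))
                                                   (bounded-away⇒≢0 0<δ (h n N≤n))))
        (small-* (bounded-* (recip-bounded {seq x} x#0) (swap-bounded (recip-bounded {seq x} x#0)))
          (small-≗ (λ m n → flip (seq x m) (seq x n)) (small-neg (cauchy x))))
        where
        flip : ∀ p q → - (p - q) ≡ q - p
        flip = solve 2 (λ p q → :- (p :- q) := q :- p) refl

  infixl 6 _⊕_
  infixl 7 _⊗_

  const : ℚ → ℝ
  const q = mkℝ (λ _ → q) (const-cauchy q)

  _⊕_ : ℝ → ℝ → ℝ
  seq    (x ⊕ y) n = seq x n + seq y n
  cauchy (x ⊕ y)   = +-cauchy x y

  ⊖_ : ℝ → ℝ
  seq    (⊖ x) n = - seq x n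
  cauchy (⊖ x)   = neg-cauchy x

  _⊗_ : ℝ → ℝ → ℝ
  seq    (x ⊗ y) n = seq x n * seq y n
  cauchy (x ⊗ y)   = *-cauchy x y

  inverse : ∀ x → IsBoundedAway (seq x) → ℝ
  seq    (inverse x x#0) n = recip (seq x n)
  cauchy (inverse x x#0)   = recip-cauchy x x#0

  private

    ≗⇒≈ : ∀ x y → (∀ n → seq x n ≡ seq y n) → x ≈ y
    ≗⇒≈ x y x≗y = mk≈ (toNull (small-≗ (λ n _ → sym (p≡q⇒p-q≡0 (x≗y n))) small-0))
      where
      p≡q⇒p-q≡0 : ∀ {p q} → p ≡ q → p - q ≡ 0ℚ
      p≡q⇒p-q≡0 {p} refl = ℚ.+-inverseʳ p

    ≈-sym : ∀ {x y} → x ≈ y → y ≈ x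
    ≈-sym {x} {y} (mk≈ x≈y) = mk≈ (toNull
      (small-≗ (λ n _ → solve 2 (λ p q → :- (p :- q) := q :- p) refl (seq x n) (seq y n))
        (small-neg (fromNull x≈y))))

    ≈-trans : ∀ {x y z} → x ≈ y → y ≈ z → x ≈ z
    ≈-trans {x} {y} {z} (mk≈ x≈y) (mk≈ y≈z) = mk≈ (toNull
      (small-≗ (λ n _ → solve 3 (λ p q r → (p :- q) :+ (q :- r) := p :- r) refl
                          (seq x n) (seq y n) (seq z n))
        (small-+ (fromNull x≈y) (fromNull y≈z))))

    ⊕-cong : ∀ {x y u v} → x ≈ y → u ≈ v → x ⊕ u ≈ y ⊕ v
    ⊕-cong {x} {y} {u} {v} (mk≈ x≈y) (mk≈ u≈v) = mk≈ (toNull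
      (small-≗ (λ n _ → solve 4 (λ p q r s → (p :- q) :+ (r :- s) := (p :+ r) :- (q :+ s)) refl
                          (seq x n) (seq y n) (seq u n) (seq v n))
        (small-+ (fromNull x≈y) (fromNull u≈v))))

    ⊗-cong : ∀ {x y u v} → x ≈ y → u ≈ v → x ⊗ u ≈ y ⊗ v
    ⊗-cong {x} {y} {u} {v} (mk≈ x≈y) (mk≈ u≈v) = mk≈ (toNull
      (small-≗ (λ n _ → sym (product-difference (seq x n) (seq u n) (seq y n) (seq v n)))
        (small-+ (small-* (bounded x) (fromNull u≈v)) (small-* (bounded v) (fromNull x≈y)))))

    ⊖-cong : ∀ {x y} → x ≈ y → ⊖ x ≈ ⊖ y
    ⊖-cong {x} {y} (mk≈ x≈y) = mk≈ (toNull
      (small-≗ (λ n _ → ℚ.neg-distrib-+ (seq x n) (- seq y n)) (small-neg (fromNull x≈y))))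

  isCommutativeRing : IsCommutativeRing _≈_ _⊕_ _⊗_ ⊖_ (const 0ℚ) (const 1ℚ)
  isCommutativeRing = record
    { isRing = record
      { +-isAbelianGroup = record
        { isGroup = record
          { isMonoid = record
            { isSemigroup = record
              { isMagma = record
                { isEquivalence = record
                  { refl  = λ {x} → ≗⇒≈ x x (λ _ → refl)
                  ; sym   = ≈-sym
                  ; trans = ≈-trans
                  }
                ; ∙-cong = ⊕-cong
                }
              ; assoc = λ x y z → ≗⇒≈ _ _ λ n → ℚ.+-assoc (seq x n) (seq y n) (seq z n)
              }
            ; identity = (λ x → ≗⇒≈ _ _ λ n → ℚ.+-identityˡ (seq x n))
                       , (λ x → ≗⇒≈ _ _ λ n → ℚ.+-identityʳ (seq x n))
            }
          ; inverse = (λ x → ≗⇒≈ _ _ λ n → ℚ.+-inverseˡ (seq x n))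
                    , (λ x → ≗⇒≈ _ _ λ n → ℚ.+-inverseʳ (seq x n))
          ; ⁻¹-cong = ⊖-cong
          }
        ; comm = λ x y → ≗⇒≈ _ _ λ n → ℚ.+-comm (seq x n) (seq y n)
        }
      ; *-cong = ⊗-cong
      ; *-assoc = λ x y z → ≗⇒≈ _ _ λ n → ℚ.*-assoc (seq x n) (seq y n) (seq z n)
      ; *-identity = (λ x → ≗⇒≈ _ _ λ n → ℚ.*-identityˡ (seq x n))
                   , (λ x → ≗⇒≈ _ _ λ n → ℚ.*-identityʳ (seq x n))
      ; distrib = (λ x y z → ≗⇒≈ _ _ λ n → ℚ.*-distribˡ-+ (seq x n) (seq y n) (seq z n))
                , (λ x y z → ≗⇒≈ _ _ λ n → ℚ.*-distribʳ-+ (seq x n) (seq y n) (seq z n))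
      }
    ; *-comm = λ x y → ≗⇒≈ _ _ λ n → ℚ.*-comm (seq x n) (seq y n)
    }

  private

    open AlgebraDefinitions _≈_ using (Invertible)

    -- A Cauchy sequence that is far from 0 at one late index stays away from 0.
    far-once⇒boundedAway : ∀ w δ → 0ℚ < δ →
      ∃[ N ] ∀ m → N ℕ.≤ m → δ ≤ ∣ seq w m ∣ → IsBoundedAway (seq w)
    far-once⇒boundedAway w δ 0<δ =
      let N , h = cauchy w (½ * δ) (0<* 0<½ 0<δ)
      in N , λ m N≤m δ≤∣w∣ → ½ * δ , 0<* 0<½ 0<δ , N , λ n N≤n →
           remainder (seq w m) (seq w m - seq w n) (seq w n)
             (solve 2 (λ p q → p := (p :- q) :+ q) refl (seq w m) (seq w n))
             δ≤∣w∣ (h m n N≤m N≤n)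

    #-irrefl : Irreflexive _≈_ _#_
    #-irrefl (mk≈ x≈y) (mk# (δ , 0<δ , M , h)) =
      let N , g = x≈y δ 0<δ
      in ℚ.<-irrefl refl (ℚ.≤-<-trans (h (M ℕ.⊔ N) (ℕ.m≤m⊔n M N)) (g (M ℕ.⊔ N) (ℕ.m≤n⊔m M N)))

    #-sym : Symmetric _#_
    #-sym {x} {y} (mk# (δ , 0<δ , N , h)) =
      mk# (δ , 0<δ , N , λ n N≤n → subst (δ ≤_) (∣p-q∣≡∣q-p∣ (seq x n) (seq y n)) (h n N≤n))

    #-cotrans : Cotransitive _#_
    #-cotrans {x} {y} (mk# (δ , 0<δ , N₀ , h)) z =
      let N₁ , far⇒x#z = far-once⇒boundedAway (x ⊕ ⊖ z) (½ * δ) (0<* 0<½ 0<δ)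
          N₂ , far⇒z#y = far-once⇒boundedAway (z ⊕ ⊖ y) (½ * δ) (0<* 0<½ 0<δ)
          M   = N₀ ℕ.⊔ (N₁ ℕ.⊔ N₂)
          N₀≤ = upper-≤ˡ N₀ (N₁ ℕ.⊔ N₂) ℕ.≤-refl
          N₁≤ = upper-≤ˡ N₁ N₂ (upper-≤ʳ N₀ (N₁ ℕ.⊔ N₂) ℕ.≤-refl)
          N₂≤ = upper-≤ʳ N₁ N₂ (upper-≤ʳ N₀ (N₁ ℕ.⊔ N₂) ℕ.≤-refl)
      in [ (λ far  → inj₁ (mk# (far⇒x#z M N₁≤ far)))
         , (λ near → inj₂ (mk# (far⇒z#y M N₂≤
             (remainder (seq x M - seq y M) (seq x M - seq z M) (seq z M - seq y M)
               (split (seq x M) (seq y M) (seq z M)) (h M N₀≤) near))))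
         ]′ (far-or-near (½ * δ) ∣ seq x M - seq z M ∣)
      where
      split : ∀ p q r → p - q ≡ (p - r) + (r - q)
      split = solve 3 (λ p q r → p :- q := (p :- r) :+ (r :- q)) refl
      far-or-near : ∀ p q → p ≤ q ⊎ q < p
      far-or-near p q with p ℚ.≤? q
      ... | yes p≤q = inj₁ p≤q
      ... | no  p≰q = inj₂ (ℚ.≰⇒> p≰q)

    #-tight : Tight _≈_ _#_
    #-tight x y = ¬#⇒≈ , #-irrefl
      where
      ¬#⇒≈ : ¬ x # y → x ≈ y
      ¬#⇒≈ ¬x#y = mk≈ λ ε 0<ε →
        let N , far⇒# = far-once⇒boundedAway (x ⊕ ⊖ y) ε 0<ε
        in N , λ n N≤n → ℚ.≰⇒> λ ε≤ → ¬x#y (mk# (far⇒# n N≤n ε≤))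

    *-inverse : ∀ w (w#0 : IsBoundedAway (seq w)) → w ⊗ inverse w w#0 ≈ const 1ℚ
    *-inverse w (δ , 0<δ , N , h) = mk≈ λ ε 0<ε → N , λ n N≤n →
      subst (_< ε) (sym (∣p-q∣≡0 (*-recip (bounded-away⇒≢0 0<δ (h n N≤n))))) 0<ε
      where
      ∣p-q∣≡0 : ∀ {p q} → p ≡ q → ∣ p - q ∣ ≡ 0ℚ
      ∣p-q∣≡0 {p} refl = cong ∣_∣ (ℚ.+-inverseʳ p)

    #⇒invertible : ∀ {x y} → x # y → Invertible (const 1ℚ) _⊗_ (x ⊕ ⊖ y)
    #⇒invertible {x} {y} (mk# x#y) =
      inverse w x#y , ≈-trans w⁻¹w≈ww⁻¹ (*-inverse w x#y) , *-inverse w x#y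
      where
      w = x ⊕ ⊖ y
      w⁻¹w≈ww⁻¹ : inverse w x#y ⊗ w ≈ w ⊗ inverse w x#y
      w⁻¹w≈ww⁻¹ = ≗⇒≈ _ _ λ n → ℚ.*-comm (recip (seq w n)) (seq w n)

    -- If ∣ t - e ∣ < ½ e and t = w u with ∣ u ∣ ≤ B, then ½ e / B ≤ ∣ w ∣.
    factor-far : ∀ e w u {B} (0<B : 0ℚ < B) → 0ℚ < e → ∣ u ∣ ≤ B → ∣ w * u - e ∣ < ½ * e →
                 ½ * e * 1/ B ⟨ 0<B ⟩ ≤ ∣ w ∣
    factor-far e w u {B} 0<B 0<e u≤B wu≈e = ℚ.*-cancelˡ-≤-pos B {{ℚ.positive 0<B}} (begin
      B * (½ * e * 1/ B ⟨ 0<B ⟩)    ≡⟨ ℚ.*-comm B (½ * e * 1/ B ⟨ 0<B ⟩) ⟩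
      ½ * e * 1/ B ⟨ 0<B ⟩ * B      ≡⟨ ℚ.*-assoc (½ * e) (1/ B ⟨ 0<B ⟩) B ⟩
      ½ * e * (1/ B ⟨ 0<B ⟩ * B)    ≡⟨ cong (½ * e *_) (trans (ℚ.*-comm _ B) (*-1/ 0<B)) ⟩
      ½ * e * 1ℚ                    ≡⟨ ℚ.*-identityʳ (½ * e) ⟩
      ½ * e                         ≤⟨ remainder e (e - w * u) (w * u) (split e (w * u))
                                         (ℚ.≤-reflexive (sym (ℚ.0≤p⇒∣p∣≡p (ℚ.<⇒≤ 0<e))))
                                         (subst (_< ½ * e) (∣p-q∣≡∣q-p∣ (w * u) e) wu≈e) ⟩
      ∣ w * u ∣                     ≡⟨ cong ∣_∣ (ℚ.*-comm w u) ⟩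
      ∣ u * w ∣                     ≤⟨ ∣*∣≤ {u} {w} (ℚ.<⇒≤ 0<B) u≤B ℚ.≤-refl ⟩
      B * ∣ w ∣                     ∎)
      where
      open ℚ.≤-Reasoning
      split : ∀ p q → p ≡ (p - q) + q
      split = solve 2 (λ p q → p := (p :- q) :+ q) refl

    invertible⇒# : ∀ {x y} → Invertible (const 1ℚ) _⊗_ (x ⊕ ⊖ y) → x # y
    invertible⇒# {x} {y} (u , _ , wu≈1) =
      let B , 0<B , M , hu = bounded u
          N , hw = null wu≈1 (½ * 1ℚ) (0<* 0<½ 0<1)
      in mk# (½ * 1ℚ * 1/ B ⟨ 0<B ⟩ , 0<* (0<* 0<½ 0<1) (0<1/ 0<B) , M ℕ.⊔ N , λ n p →
           factor-far 1ℚ (seq x n - seq y n) (seq u n) 0<B 0<1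
             (hu n n (upper-≤ˡ M N p) (upper-≤ˡ M N p)) (hw n (upper-≤ʳ M N p)))

  ℝ-heytingField : HeytingField 0ℓ 0ℓ 0ℓ
  ℝ-heytingField = record
    { _#_ = _#_
    ; isHeytingField = record
      { isHeytingCommutativeRing = record
        { isCommutativeRing = isCommutativeRing
        ; isApartnessRelation = record
          { irrefl = #-irrefl ; sym = #-sym ; cotrans = #-cotrans }
        ; #⇒invertible = #⇒invertible
        ; invertible⇒# = invertible⇒#
        }
      ; tight = #-tight
      }
    }

  x#0⇒x²+y²#0 : ∀ x y → x # const 0ℚ → x ⊗ x ⊕ y ⊗ y # const 0ℚ
  x#0⇒x²+y²#0 x y (mk# (δ , 0<δ , N , h)) =
    mk# (δ * δ , 0<* 0<δ 0<δ , N , λ n N≤n →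
      let a = seq x n
          b = seq y n
          δ≤∣a∣ : δ ≤ ∣ a ∣
          δ≤∣a∣ = subst (λ t → δ ≤ ∣ t ∣) (ℚ.+-identityʳ a) (h n N≤n)
          open ℚ.≤-Reasoning
      in begin
        δ * δ                  ≤⟨ *-mono (ℚ.<⇒≤ 0<δ) (ℚ.0≤∣p∣ a) δ≤∣a∣ δ≤∣a∣ ⟩
        ∣ a ∣ * ∣ a ∣          ≡⟨ square a ⟩
        a * a                  ≡⟨ ℚ.+-identityʳ (a * a) ⟨
        a * a + 0ℚ             ≤⟨ ℚ.+-monoʳ-≤ (a * a) (0≤square b) ⟩
        a * a + b * b          ≡⟨ ℚ.0≤p⇒∣p∣≡p (ℚ.+-mono-≤ (0≤square a) (0≤square b)) ⟨
        ∣ a * a + b * b ∣      ≡⟨ cong ∣_∣ (ℚ.+-identityʳ (a * a + b * b)) ⟨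
        ∣ a * a + b * b - 0ℚ ∣ ∎)
    where
    square : ∀ p → ∣ p ∣ * ∣ p ∣ ≡ p * p
    square p with ℚ.∣p∣≡p∨∣p∣≡-p p
    ... | inj₁ e rewrite e = refl
    ... | inj₂ e rewrite e = solve 1 (λ p → (:- p) :* (:- p) := p :* p) refl p
    0≤square : ∀ p → 0ℚ ≤ p * p
    0≤square p = subst (0ℚ ≤_) (square p) (*-mono ℚ.≤-refl (ℚ.0≤∣p∣ p) (ℚ.0≤∣p∣ p) (ℚ.0≤∣p∣ p))

module HeytingFieldProperties (F : HeytingField 0ℓ 0ℓ 0ℓ) where

  open HeytingField F hiding (refl; sym; trans)
  open HeytingField F using () renaming (refl to ≈-refl; sym to ≈-sym; trans to ≈-trans)
  open HeytingProperties heytingCommutativeRing public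

  commutativeRing : CommutativeRing 0ℓ 0ℓ
  commutativeRing = record { isCommutativeRing = isCommutativeRing }

  open CommutativeRing commutativeRing using (ring; semiring)
  open Semiring semiring using (rawSemiring)
  open RawSemiringDefinitions rawSemiring public using (_^_)
  open RawSemiringDefinitions rawSemiring using () renaming (_×_ to _•_)
  open RingProperties ring using (-‿distribʳ-*)

  open SetoidReasoning setoid

  fromℕ : ℕ → Carrier
  fromℕ n = n • 1#

  -- These proofs have no computational interest, and are large when unfolded.
  abstract

    x#y⇒x-y#0 : ∀ {x y} → x # y → x - y # 0#
    x#y⇒x-y#0 {x} {y} x#y = let u , u[x-y]≈1 , _ = #⇒invertible x#y in
      invertibleˡ⇒# (u , ≈-trans (*-congˡ (x-0≈x (x - y))) u[x-y]≈1)

    x-y#0⇒x#y : ∀ {x y} → x - y # 0# → x # y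
    x-y#0⇒x#y {x} {y} x-y#0 = let u , u[x-y-0]≈1 , _ = #⇒invertible x-y#0 in
      invertibleˡ⇒# (u , ≈-trans (*-congˡ (≈-sym (x-0≈x (x - y)))) u[x-y-0]≈1)

    xy#0⇒x#0 : ∀ {x y} → x * y # 0# → x # 0#
    xy#0⇒x#0 {x} {y} xy#0 = let u , _ , [xy-0]u≈1 = #⇒invertible xy#0 in
      invertibleʳ⇒# (y * u , (begin
        (x - 0#) * (y * u)  ≈⟨ *-congʳ (x-0≈x x) ⟩
        x * (y * u)         ≈⟨ *-assoc x y u ⟨
        x * y * u           ≈⟨ *-congʳ (x-0≈x (x * y)) ⟨
        (x * y - 0#) * u    ≈⟨ [xy-0]u≈1 ⟩
        1#                  ∎))

    x*y#0 : ∀ {x y} → x # 0# → y # 0# → x * y # 0#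
    x*y#0 = x#0y#0→xy#0

    x#0⇒x^n#0 : ∀ {x} n → x # 0# → x ^ n # 0#
    x#0⇒x^n#0 zero    x#0 = 1#0
    x#0⇒x^n#0 (suc n) x#0 = x*y#0 x#0 (x#0⇒x^n#0 n x#0)

    x^n#1⇒x#1 : ∀ {x} n → x ^ n # 1# → x # 1#
    x^n#1⇒x#1 zero 1#1 = ⊥-elim (#-irrefl ≈-refl 1#1)
    x^n#1⇒x#1 {x} (suc n) x^[1+n]#1 with #-cotrans x^[1+n]#1 x
    ... | inj₂ x#1 = x#1
    ... | inj₁ x^[1+n]#x = x^n#1⇒x#1 n (x-y#0⇒x#y (xy#0⇒x#0 (#-congʳ factor (x#y⇒x-y#0 x^[1+n]#x))))
      where
      factor : x * x ^ n - x ≈ (x ^ n - 1#) * x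
      factor = begin
        x * x ^ n - x         ≈⟨ +-congˡ (-‿cong (*-identityʳ x)) ⟨
        x * x ^ n - x * 1#    ≈⟨ +-congˡ (-‿distribʳ-* x 1#) ⟩
        x * x ^ n + x * - 1#  ≈⟨ distribˡ x (x ^ n) (- 1#) ⟨
        x * (x ^ n - 1#)      ≈⟨ *-comm x (x ^ n - 1#) ⟩
        (x ^ n - 1#) * x      ∎

  -- #⇒invertible inverts y - 0# rather than y; see y*[x/y]≈x.
  infixl 7 _/_⟨_⟩

  _/_⟨_⟩ : (x y : Carrier) → y # 0# → Carrier
  x / y ⟨ y#0 ⟩ = x * proj₁ (#⇒invertible y#0)

  y*[x/y]≈x : ∀ x {y} (y#0 : y # 0#) → y * (x / y ⟨ y#0 ⟩) ≈ x
  y*[x/y]≈x x {y} y#0 = let u , u[y-0]≈1 , _ = #⇒invertible y#0 in begin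
    y * (x * u)         ≈⟨ *-comm y (x * u) ⟩
    x * u * y           ≈⟨ *-assoc x u y ⟩
    x * (u * y)         ≈⟨ *-congˡ (*-congˡ (x-0≈x y)) ⟨
    x * (u * (y - 0#))  ≈⟨ *-congˡ u[y-0]≈1 ⟩
    x * 1#              ≈⟨ *-identityʳ x ⟩
    x                   ∎

-- F(i) for a field F in which x² + y² vanishes only if x and y do.

SquaresAnisotropic : HeytingField 0ℓ 0ℓ 0ℓ → Set
SquaresAnisotropic F = ∀ x y → x # 0# → x * x + y * y # 0#
  where open HeytingField F

module Complexification (F : HeytingField 0ℓ 0ℓ 0ℓ) (x#0⇒x²+y²#0 : SquaresAnisotropic F) where

  open HeytingField F using (Carrier; _≈_; _#_; _+_; _*_; -_; _-_; 0#; 1#)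

  private
    module F = HeytingField F
    module FP = HeytingFieldProperties F
    open SetoidReasoning (CommutativeRing.setoid FP.commutativeRing)
    open RingProperties (CommutativeRing.ring FP.commutativeRing)
      using (-1*x≈-x; -‿distribʳ-*; -‿involutive)
    open NaturalCoefficients (CommutativeRing.commutativeSemiring FP.commutativeRing)
      using (solve; _:+_; _:*_; _:=_)

  infix 4 _≈ᶜ_ _#ᶜ_
  infixl 6 _+ᶜ_
  infixl 7 _*ᶜ_
  infix 8 -ᶜ_
  infix 5 _+i_

  record Complex : Set where
    no-eta-equality
    constructor _+i_
    field
      re im : Carrier
  open Complex public

  record _≈ᶜ_ (z w : Complex) : Set where
    constructor _,_
    field
      re-≈ : re z ≈ re w
      im-≈ : im z ≈ im w
  open _≈ᶜ_

  data _#ᶜ_ (z w : Complex) : Set where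
    re-# : re z # re w → z #ᶜ w
    im-# : im z # im w → z #ᶜ w

  _+ᶜ_ : Complex → Complex → Complex
  re (z +ᶜ w) = re z + re w
  im (z +ᶜ w) = im z + im w

  -ᶜ_ : Complex → Complex
  re (-ᶜ z) = - re z
  im (-ᶜ z) = - im z

  _*ᶜ_ : Complex → Complex → Complex
  re (z *ᶜ w) = re z * re w - im z * im w
  im (z *ᶜ w) = re z * im w + im z * re w

  0ᶜ 1ᶜ : Complex
  0ᶜ = 0# +i 0#
  1ᶜ = 1# +i 0#

  private
    open AlgebraDefinitions _≈ᶜ_

    *ᶜ-comm : Commutative _*ᶜ_
    *ᶜ-comm z w =
        F.+-cong (F.*-comm (re z) (re w)) (F.-‿cong (F.*-comm (im z) (im w)))
      , F.trans (F.+-comm (re z * im w) (im z * re w))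
                (F.+-cong (F.*-comm (im z) (re w)) (F.*-comm (re z) (im w)))

    *ᶜ-identityʳ : RightIdentity 1ᶜ _*ᶜ_
    *ᶜ-identityʳ z =
        F.trans (F.+-cong (F.*-identityʳ (re z)) (F.-‿cong (F.zeroʳ (im z)))) (FP.x-0≈x (re z))
      , F.trans (F.+-cong (F.zeroʳ (re z)) (F.*-identityʳ (im z))) (F.+-identityˡ (im z))

    -- The semiring solver applies once subtraction is written with n = - 1#.
    n : Carrier
    n = - 1#

    minus : ∀ x y → x - y ≈ x + n * y
    minus x y = F.+-congˡ (F.sym (-1*x≈-x y))

    *ᶜ-distribˡ : _*ᶜ_ DistributesOverˡ _+ᶜ_
    *ᶜ-distribˡ z w v = re-part , im-part
      where
      a = re z ; b = im z
      c = re w ; d = im w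
      e = re v ; f = im v
      re-part : a * (c + e) - b * (d + f) ≈ (a * c - b * d) + (a * e - b * f)
      re-part = begin
        a * (c + e) - b * (d + f)                          ≈⟨ minus _ _ ⟩
        a * (c + e) + n * (b * (d + f))
          ≈⟨ solve 7 (λ a b c d e f n →
               a :* (c :+ e) :+ n :* (b :* (d :+ f))
               := (a :* c :+ n :* (b :* d)) :+ (a :* e :+ n :* (b :* f)))
               F.refl a b c d e f n ⟩
        (a * c + n * (b * d)) + (a * e + n * (b * f))      ≈⟨ F.+-cong (minus _ _) (minus _ _) ⟨
        (a * c - b * d) + (a * e - b * f)                  ∎
      im-part : a * (d + f) + b * (c + e) ≈ (a * d + b * c) + (a * f + b * e)
      im-part = solve 6 (λ a b c d e f →
        a :* (d :+ f) :+ b :* (c :+ e) := (a :* d :+ b :* c) :+ (a :* f :+ b :* e))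
        F.refl a b c d e f

    *ᶜ-assoc : Associative _*ᶜ_
    *ᶜ-assoc z w v = re-part , im-part
      where
      a = re z ; b = im z
      c = re w ; d = im w
      e = re v ; f = im v
      re-part : (a * c - b * d) * e - (a * d + b * c) * f ≈ a * (c * e - d * f) - b * (c * f + d * e)
      re-part = begin
        (a * c - b * d) * e - (a * d + b * c) * f              ≈⟨ minus _ _ ⟩
        (a * c - b * d) * e + n * ((a * d + b * c) * f)        ≈⟨ F.+-congʳ (F.*-congʳ (minus _ _)) ⟩
        (a * c + n * (b * d)) * e + n * ((a * d + b * c) * f)
          ≈⟨ solve 7 (λ a b c d e f n →
               (a :* c :+ n :* (b :* d)) :* e :+ n :* ((a :* d :+ b :* c) :* f)
               := a :* (c :* e :+ n :* (d :* f)) :+ n :* (b :* (c :* f :+ d :* e)))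
               F.refl a b c d e f n ⟩
        a * (c * e + n * (d * f)) + n * (b * (c * f + d * e))  ≈⟨ F.+-congʳ (F.*-congˡ (minus _ _)) ⟨
        a * (c * e - d * f) + n * (b * (c * f + d * e))        ≈⟨ minus _ _ ⟨
        a * (c * e - d * f) - b * (c * f + d * e)              ∎
      im-part : (a * c - b * d) * f + (a * d + b * c) * e ≈ a * (c * f + d * e) + b * (c * e - d * f)
      im-part = begin
        (a * c - b * d) * f + (a * d + b * c) * e              ≈⟨ F.+-congʳ (F.*-congʳ (minus _ _)) ⟩
        (a * c + n * (b * d)) * f + (a * d + b * c) * e
          ≈⟨ solve 7 (λ a b c d e f n →
               (a :* c :+ n :* (b :* d)) :* f :+ (a :* d :+ b :* c) :* e
               := a :* (c :* f :+ d :* e) :+ b :* (c :* e :+ n :* (d :* f)))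
               F.refl a b c d e f n ⟩
        a * (c * f + d * e) + b * (c * e + n * (d * f))        ≈⟨ F.+-congˡ (F.*-congˡ (minus _ _)) ⟨
        a * (c * f + d * e) + b * (c * e - d * f)              ∎

    ≈ᶜ-trans : ∀ {z w v} → z ≈ᶜ w → w ≈ᶜ v → z ≈ᶜ v
    ≈ᶜ-trans (p , q) (r , s) = F.trans p r , F.trans q s

  isCommutativeRing : IsCommutativeRing _≈ᶜ_ _+ᶜ_ _*ᶜ_ -ᶜ_ 0ᶜ 1ᶜ
  isCommutativeRing = record
    { isRing = record
      { +-isAbelianGroup = record
        { isGroup = record
          { isMonoid = record
            { isSemigroup = record
              { isMagma = record
                { isEquivalence = record
                  { refl  = F.refl , F.refl
                  ; sym   = λ { (p , q) → F.sym p , F.sym q }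
                  ; trans = ≈ᶜ-trans
                  }
                ; ∙-cong = λ { (p , q) (r , s) → F.+-cong p r , F.+-cong q s }
                }
              ; assoc = λ z w v → F.+-assoc _ _ _ , F.+-assoc _ _ _
              }
            ; identity = (λ z → F.+-identityˡ _ , F.+-identityˡ _)
                       , (λ z → F.+-identityʳ _ , F.+-identityʳ _)
            }
          ; inverse = (λ z → F.-‿inverseˡ _ , F.-‿inverseˡ _)
                    , (λ z → F.-‿inverseʳ _ , F.-‿inverseʳ _)
          ; ⁻¹-cong = λ { (p , q) → F.-‿cong p , F.-‿cong q }
          }
        ; comm = λ z w → F.+-comm _ _ , F.+-comm _ _
        }
      ; *-cong = λ { (p , q) (r , s) →
            F.+-cong (F.*-cong p r) (F.-‿cong (F.*-cong q s))
          , F.+-cong (F.*-cong p s) (F.*-cong q r) }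
      ; *-assoc = *ᶜ-assoc
      ; *-identity = (λ z → ≈ᶜ-trans (*ᶜ-comm 1ᶜ z) (*ᶜ-identityʳ z)) , *ᶜ-identityʳ
      ; distrib = *ᶜ-distribˡ
                , (λ z w v → ≈ᶜ-trans (*ᶜ-comm (w +ᶜ v) z) (≈ᶜ-trans (*ᶜ-distribˡ z w v)
                    (F.+-cong (re-≈ (*ᶜ-comm z w)) (re-≈ (*ᶜ-comm z v))
                    , F.+-cong (im-≈ (*ᶜ-comm z w)) (im-≈ (*ᶜ-comm z v)))))
      }
    ; *-comm = *ᶜ-comm
    }

  private

    norm : Complex → Carrier
    norm z = re z * re z + im z * im z

    #⇒norm#0 : ∀ {z w} → z #ᶜ w → norm (z +ᶜ -ᶜ w) # 0#
    #⇒norm#0 (re-# a#c) = x#0⇒x²+y²#0 _ _ (FP.x#y⇒x-y#0 a#c)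
    #⇒norm#0 (im-# b#d) = FP.#-congʳ (F.+-comm _ _) (x#0⇒x²+y²#0 _ _ (FP.x#y⇒x-y#0 b#d))

    conjugate-inverse : ∀ z u → norm z * u ≈ 1# → z *ᶜ (re z * u +i - (im z * u)) ≈ᶜ 1ᶜ
    conjugate-inverse z u nu≈1 = re-part , im-part
      where
      a = re z ; b = im z
      re-part : a * (a * u) - b * - (b * u) ≈ 1#
      re-part = begin
        a * (a * u) - b * - (b * u)  ≈⟨ F.+-congˡ (-‿distribʳ-* b (- (b * u))) ⟩
        a * (a * u) + b * - - (b * u)  ≈⟨ F.+-congˡ (F.*-congˡ (-‿involutive (b * u))) ⟩
        a * (a * u) + b * (b * u)    ≈⟨ F.+-cong (F.*-assoc a a u) (F.*-assoc b b u) ⟨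
        a * a * u + b * b * u        ≈⟨ F.distribʳ u (a * a) (b * b) ⟨
        (a * a + b * b) * u          ≈⟨ nu≈1 ⟩
        1#                           ∎
      im-part : a * - (b * u) + b * (a * u) ≈ 0#
      im-part = begin
        a * - (b * u) + b * (a * u)  ≈⟨ F.+-congˡ (solve 3 (λ a b u → b :* (a :* u) := a :* (b :* u)) F.refl a b u) ⟩
        a * - (b * u) + a * (b * u)  ≈⟨ F.distribˡ a (- (b * u)) (b * u) ⟨
        a * (- (b * u) + b * u)      ≈⟨ F.*-congˡ (F.-‿inverseˡ (b * u)) ⟩
        a * 0#                       ≈⟨ F.zeroʳ a ⟩
        0#                           ∎

    #⇒invertible : ∀ {z w} → z #ᶜ w → Invertible 1ᶜ _*ᶜ_ (z +ᶜ -ᶜ w)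
    #⇒invertible {z} {w} z#w =
      v⁻¹ , ≈ᶜ-trans (*ᶜ-comm v⁻¹ v) vv⁻¹≈1 , vv⁻¹≈1
      where
      v = z +ᶜ -ᶜ w
      u = 1# FP./ norm v ⟨ #⇒norm#0 z#w ⟩
      v⁻¹ = re v * u +i - (im v * u)
      vv⁻¹≈1 : v *ᶜ v⁻¹ ≈ᶜ 1ᶜ
      vv⁻¹≈1 = conjugate-inverse v u (FP.y*[x/y]≈x 1# (#⇒norm#0 z#w))

    invertible⇒# : ∀ {z w} → Invertible 1ᶜ _*ᶜ_ (z +ᶜ -ᶜ w) → z #ᶜ w
    invertible⇒# (u , _ , (re≈1 , _))
      with F.#-cotrans (FP.x-y#0⇒x#y (FP.#-congʳ (F.sym re≈1) FP.1#0)) 0#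
    ... | inj₁ ac#0 = re-# (FP.x-y#0⇒x#y (FP.xy#0⇒x#0 ac#0))
    ... | inj₂ 0#bd = im-# (FP.x-y#0⇒x#y (FP.xy#0⇒x#0 (F.#-sym 0#bd)))

    #ᶜ-irrefl : Irreflexive _≈ᶜ_ _#ᶜ_
    #ᶜ-irrefl (p , _) (re-# r) = F.#-irrefl p r
    #ᶜ-irrefl (_ , q) (im-# r) = F.#-irrefl q r

    #ᶜ-sym : Symmetric _#ᶜ_
    #ᶜ-sym (re-# p) = re-# (F.#-sym p)
    #ᶜ-sym (im-# q) = im-# (F.#-sym q)

    #ᶜ-cotrans : Cotransitive _#ᶜ_
    #ᶜ-cotrans (re-# p) v = [ inj₁ ∘ re-# , inj₂ ∘ re-# ]′ (F.#-cotrans p (re v))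
    #ᶜ-cotrans (im-# q) v = [ inj₁ ∘ im-# , inj₂ ∘ im-# ]′ (F.#-cotrans q (im v))

    #ᶜ-tight : Tight _≈ᶜ_ _#ᶜ_
    #ᶜ-tight z w = (λ ¬z#w → proj₁ (F.tight _ _) (¬z#w ∘ re-#) , proj₁ (F.tight _ _) (¬z#w ∘ im-#))
                 , #ᶜ-irrefl

  heytingField : HeytingField 0ℓ 0ℓ 0ℓ
  heytingField = record
    { _#_ = _#ᶜ_
    ; isHeytingField = record
      { isHeytingCommutativeRing = record
        { isCommutativeRing = isCommutativeRing
        ; isApartnessRelation = record
          { irrefl = #ᶜ-irrefl ; sym = #ᶜ-sym ; cotrans = #ᶜ-cotrans }
        ; #⇒invertible = #⇒invertible
        ; invertible⇒# = invertible⇒#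
        }
      ; tight = #ᶜ-tight
      }
    }

ℂ-heytingField : HeytingField 0ℓ 0ℓ 0ℓ
ℂ-heytingField = Complexification.heytingField Real.ℝ-heytingField Real.x#0⇒x²+y²#0

open HeytingField ℂ-heytingField public
  using (_≈_; _#_; _+_; _*_; _-_; 0#; 1#) renaming (Carrier to ℂ)

open HeytingFieldProperties ℂ-heytingField public
  using (_^_; _/_⟨_⟩; fromℕ; x#y⇒x-y#0; x*y#0; x#0⇒x^n#0; x^n#1⇒x#1)

-- Finite sets of natural numbers, and sums over them.

record Finite (P : ℕ → Set) : Set where
  field
    elements : List ℕ
    unique   : Unique elements
    complete : ∀ n → n ∈ elements ⇔ P n

∑ : ∀ {P} → Finite P → (ℕ → ℂ) → ℂ
∑ A f = foldr _+_ 0# (map f (Finite.elements A))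

Representable : ℕ → ℕ → ℕ → Set
Representable a b n = ∃[ x ] ∃[ y ] n ≡ a ℕ.* x ℕ.+ b ℕ.* y

NR : ℕ → ℕ → ℕ → Set
NR a b n = ¬ Representable a b n

module _ (a b : ℕ) .{{_ : ℕ.NonZero a}} .{{_ : ℕ.NonZero b}} where

  representable? : ∀ n → Dec (Representable a b n)
  representable? n = map′ forget bound
    (ℕ.anyUpTo? (λ x → ℕ.anyUpTo? (λ y → n ℕ.≟ a ℕ.* x ℕ.+ b ℕ.* y) (suc n)) (suc n))
    where
    forget : (∃ λ x → x ℕ.< suc n × ∃ λ y → y ℕ.< suc n × n ≡ a ℕ.* x ℕ.+ b ℕ.* y) →
             Representable a b n
    forget (x , _ , y , _ , eq) = x , y , eq
    bound : Representable a b n →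
            ∃ λ x → x ℕ.< suc n × ∃ λ y → y ℕ.< suc n × n ≡ a ℕ.* x ℕ.+ b ℕ.* y
    bound (x , y , refl) =
        x , ℕ.s≤s (ℕ.≤-trans (ℕ.m≤n*m x a) (ℕ.m≤m+n (a ℕ.* x) (b ℕ.* y)))
      , y , ℕ.s≤s (ℕ.≤-trans (ℕ.m≤n*m y b) (ℕ.m≤n+m (b ℕ.* y) (a ℕ.* x))) , refl

private
  -- Reduce the solution x of a x ≡ n (mod b) modulo b, so that a x < a b ≤ n.
  bézout⇒representable : ∀ a b u v n .{{_ : ℕ.NonZero b}} →
    1 ℕ.+ v ℕ.* b ≡ u ℕ.* a → a ℕ.* b ℕ.≤ n → Representable a b n
  bézout⇒representable a b u v n 1+vb≡ua ab≤n =
    r , k , (begin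
      n                        ≡⟨ ℕ.m+[n∸m]≡n ar≤n ⟨
      a ℕ.* r ℕ.+ (n ∸ a ℕ.* r) ≡⟨ cong (a ℕ.* r ℕ.+_) n∸ar≡kb ⟩
      a ℕ.* r ℕ.+ k ℕ.* b       ≡⟨ cong (a ℕ.* r ℕ.+_) (ℕ.*-comm k b) ⟩
      a ℕ.* r ℕ.+ b ℕ.* k       ∎)
    where
    open ≡-Reasoning
    r q k : ℕ
    r = (n ℕ.* u) ℕ.% b
    q = (n ℕ.* u) ℕ./ b
    k = a ℕ.* q ∸ n ℕ.* v

    ar≤n : a ℕ.* r ℕ.≤ n
    ar≤n = ℕ.≤-trans (ℕ.*-monoʳ-≤ a (ℕ.<⇒≤ (ℕ.m%n<n (n ℕ.* u) b))) ab≤n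

    n+nvb≡ar+aqb : n ℕ.+ n ℕ.* v ℕ.* b ≡ a ℕ.* r ℕ.+ a ℕ.* q ℕ.* b
    n+nvb≡ar+aqb = begin
      n ℕ.+ n ℕ.* v ℕ.* b             ≡⟨ cong₂ ℕ._+_ (sym (ℕ.*-identityʳ n)) (ℕ.*-assoc n v b) ⟩
      n ℕ.* 1 ℕ.+ n ℕ.* (v ℕ.* b)     ≡⟨ ℕ.*-distribˡ-+ n 1 (v ℕ.* b) ⟨
      n ℕ.* (1 ℕ.+ v ℕ.* b)           ≡⟨ cong (n ℕ.*_) 1+vb≡ua ⟩
      n ℕ.* (u ℕ.* a)                 ≡⟨ ℕ.*-assoc n u a ⟨
      n ℕ.* u ℕ.* a                   ≡⟨ ℕ.*-comm (n ℕ.* u) a ⟩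
      a ℕ.* (n ℕ.* u)                 ≡⟨ cong (a ℕ.*_) (ℕ.m≡m%n+[m/n]*n (n ℕ.* u) b) ⟩
      a ℕ.* (r ℕ.+ q ℕ.* b)           ≡⟨ ℕ.*-distribˡ-+ a r (q ℕ.* b) ⟩
      a ℕ.* r ℕ.+ a ℕ.* (q ℕ.* b)     ≡⟨ cong (a ℕ.* r ℕ.+_) (ℕ.*-assoc a q b) ⟨
      a ℕ.* r ℕ.+ a ℕ.* q ℕ.* b       ∎

    n∸ar≡kb : n ∸ a ℕ.* r ≡ k ℕ.* b
    n∸ar≡kb = begin
      n ∸ a ℕ.* r                                          ≡⟨ ℕ.[m+n]∸[m+o]≡n∸o (n ℕ.* v ℕ.* b) n (a ℕ.* r) ⟨
      n ℕ.* v ℕ.* b ℕ.+ n ∸ (n ℕ.* v ℕ.* b ℕ.+ a ℕ.* r)   ≡⟨ cong₂ _∸_ (ℕ.+-comm (n ℕ.* v ℕ.* b) n) (ℕ.+-comm (n ℕ.* v ℕ.* b) (a ℕ.* r)) ⟩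
      n ℕ.+ n ℕ.* v ℕ.* b ∸ (a ℕ.* r ℕ.+ n ℕ.* v ℕ.* b)   ≡⟨ cong (_∸ (a ℕ.* r ℕ.+ n ℕ.* v ℕ.* b)) n+nvb≡ar+aqb ⟩
      a ℕ.* r ℕ.+ a ℕ.* q ℕ.* b ∸ (a ℕ.* r ℕ.+ n ℕ.* v ℕ.* b) ≡⟨ ℕ.[m+n]∸[m+o]≡n∸o (a ℕ.* r) (a ℕ.* q ℕ.* b) (n ℕ.* v ℕ.* b) ⟩
      a ℕ.* q ℕ.* b ∸ n ℕ.* v ℕ.* b                        ≡⟨ ℕ.*-distribʳ-∸ b (a ℕ.* q) (n ℕ.* v) ⟨
      k ℕ.* b                                              ∎

coprime⇒representable : ∀ a b .{{_ : ℕ.NonZero a}} .{{_ : ℕ.NonZero b}} → gcd a b ≡ 1 →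
                        ∀ n → a ℕ.* b ℕ.≤ n → Representable a b n
coprime⇒representable a b gcd≡1 n ab≤n
  with Bézout.identity (subst (GCD a b) gcd≡1 (gcd-GCD a b))
... | Bézout.+- u v eq = bézout⇒representable a b u v n eq ab≤n
... | Bézout.-+ u v eq =
  let x , y , n≡bx+ay = bézout⇒representable b a v u n eq (subst (ℕ._≤ n) (ℕ.*-comm a b) ab≤n)
  in y , x , trans n≡bx+ay (ℕ.+-comm (b ℕ.* x) (a ℕ.* y))

NR-finite : ∀ a b .{{_ : ℕ.NonZero a}} .{{_ : ℕ.NonZero b}} → gcd a b ≡ 1 → Finite (NR a b)
NR-finite a b gcd≡1 = record
  { elements = filter nonRepresentable? (upTo (a ℕ.* b))
  ; unique   = Unique.filter⁺ nonRepresentable? (Unique.upTo⁺ (a ℕ.* b))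
  ; complete = λ n → mk⇔
      (proj₂ ∘ ∈-filter⁻ nonRepresentable? {xs = upTo (a ℕ.* b)})
      (λ ¬rep → ∈-filter⁺ nonRepresentable?
        (∈-upTo⁺ (ℕ.≰⇒> (¬rep ∘ coprime⇒representable a b gcd≡1 n))) ¬rep)
  }
  where
  nonRepresentable? : ∀ n → Dec (NR a b n)
  nonRepresentable? n = ¬? (representable? a b n)

-- The exponent n ∸ 1 is never truncated, since 0 is representable.
S : (m : ℕ) (ƛ : ℂ) (a b : ℕ) .{{_ : ℕ.NonZero a}} .{{_ : ℕ.NonZero b}} → gcd a b ≡ 1 → ℂ
S m ƛ a b gcd≡1 = ∑ (NR-finite a b gcd≡1) λ n → ƛ ^ (n ∸ 1) * fromℕ n ^ m

{-# OPTIONS --safe #-}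
module Submission where

-- The translate b + NR, together with [0, b), is a rearrangement of NR together
-- with the Apéry set {a i ∣ i < b}.  Hence ∑_NR (f (b + n) - f n) equals
-- ∑_{i<b} f (a i) - ∑_{i<b} f i.  For f n = ƛⁿ and f n = n ƛⁿ the left-hand side
-- expresses ∑_NR ƛⁿ and ∑_NR n ƛⁿ, while the sums on the right telescope.

open import Defs using (Finite; Representable; NR; representable?)
open import Level using (Level)
open import Algebra.Bundles using (CommutativeRing)
import Algebra.Properties.Group as GroupProperties
import Algebra.Properties.Semiring.Exp as Exp
import Algebra.Properties.Semiring.Mult as Mult
import Algebra.Solver.Ring.NaturalCoefficients.Default as NaturalCoefficients
open import Data.List.Base using (List; []; _∷_; _++_; [_]; foldr; map; upTo)
import Data.List.Properties as List
open import Data.List.Membership.Propositional using (_∈_)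
open import Data.List.Membership.Propositional.Properties
  using (∈-++⁺ˡ; ∈-++⁺ʳ; ∈-++⁻; ∈-map⁺; ∈-map⁻; ∈-upTo⁺; ∈-upTo⁻)
open import Data.List.Membership.Propositional.Properties.WithK using (unique∧set⇒bag)
open import Data.List.Relation.Binary.BagAndSetEquality using (∼bag⇒↭)
open import Data.List.Relation.Binary.Permutation.Propositional using (_↭_; ↭⇒↭ₛ)
import Data.List.Relation.Binary.Permutation.Setoid.Properties as Permutation
import Data.List.Relation.Unary.Unique.Propositional.Properties as Unique
open import Data.Nat.Base as ℕ using (ℕ; zero; suc; NonZero; _∸_)
open import Data.Nat.Coprimality using (coprime-divisor; gcd≡1⇒coprime)
import Data.Nat.Coprimality as Coprimality
open import Data.Nat.Divisibility using (_∣_; divides; ∣⇒≤)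
open import Data.Nat.GCD using (gcd)
import Data.Nat.Properties as ℕ
import Data.Nat.Solver as ℕ-Solver
open import Data.Product.Base using (∃-syntax; _×_; _,_)
open import Data.Sum.Base using (_⊎_; inj₁; inj₂)
open import Function.Base using (_∘_)
open import Function.Bundles using (mk⇔; Equivalence)
open import Relation.Binary.PropositionalEquality
  using (_≡_; refl; sym; trans; cong; subst; setoid; module ≡-Reasoning)
import Relation.Binary.Reasoning.Setoid as SetoidReasoning
open import Relation.Nullary using (¬_; yes; no; contradiction)

private
  variable
    ℓ₁ ℓ₂ ℓ₃ : Level

-- Representable numbers, the Apéry set, and the shift by `b`.

module _ (a b : ℕ) .{{_ : NonZero a}} .{{_ : NonZero b}} where

  open ℕ-Solver.+-*-Solver

  private
    -- For coprime `a` and `b` these are the representable `n` that do not remain representable when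
    -- `b` is taken away.
    _∈Apéry : ℕ → Set
    n ∈Apéry = ∃[ i ] i ℕ.< b × n ≡ a ℕ.* i

  representable-+ : ∀ {n} → Representable a b n → Representable a b (b ℕ.+ n)
  representable-+ (x , y , refl) = x , suc y ,
    solve 4 (λ a b x y → b :+ (a :* x :+ b :* y) := a :* x :+ b :* (con 1 :+ y)) refl a b x y

  -- A positive coefficient of `b` gives up one copy of `b`. If that coefficient is zero and `x` is
  -- at least `b`, then `b` copies of `a` are traded for `a` copies of `b`, which reduces to the
  -- first case.
  representable⇒shift⊎Apéry : ∀ {n} → Representable a b n →
                              (∃[ m ] Representable a b m × n ≡ b ℕ.+ m) ⊎ n ∈Apéry
  representable⇒shift⊎Apéry (x , suc y , refl) = inj₁ (a ℕ.* x ℕ.+ b ℕ.* y , (x , y , refl) ,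
    solve 4 (λ a b x y → a :* x :+ b :* (con 1 :+ y) := b :+ (a :* x :+ b :* y)) refl a b x y)
  representable⇒shift⊎Apéry (x , zero , refl) with x ℕ.<? b
  ... | yes x<b = inj₂ (x , x<b , trans (cong (a ℕ.* x ℕ.+_) (ℕ.*-zeroʳ b)) (ℕ.+-identityʳ _))
  -- Of the `a` copies of `b` obtained by the trade one is the shift, so `pred a` remain; this uses
  -- that `a` is nonzero.
  ... | no x≮b = inj₁ (a ℕ.* x′ ℕ.+ b ℕ.* ℕ.pred a , (x′ , ℕ.pred a , refl) , (begin
    a ℕ.* x ℕ.+ b ℕ.* 0
      ≡⟨ cong (λ t → a ℕ.* t ℕ.+ b ℕ.* 0) (ℕ.m+[n∸m]≡n (ℕ.≮⇒≥ x≮b)) ⟨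
    a ℕ.* (b ℕ.+ x′) ℕ.+ b ℕ.* 0
      ≡⟨ solve 3 (λ a b x → a :* (b :+ x) :+ b :* con 0 := a :* x :+ b :* a) refl a b x′ ⟩
    a ℕ.* x′ ℕ.+ b ℕ.* a
      ≡⟨ cong (λ t → a ℕ.* x′ ℕ.+ b ℕ.* t) (ℕ.suc-pred a) ⟨
    a ℕ.* x′ ℕ.+ b ℕ.* suc (ℕ.pred a)
      ≡⟨ solve 4 (λ a b x y → a :* x :+ b :* (con 1 :+ y) := b :+ (a :* x :+ b :* y))
           refl a b x′ (ℕ.pred a) ⟩
    b ℕ.+ (a ℕ.* x′ ℕ.+ b ℕ.* ℕ.pred a) ∎))
    where
    open ≡-Reasoning
    x′ = x ∸ b

  Apéry⇒representable : ∀ {n} → n ∈Apéry → Representable a b n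
  Apéry⇒representable (i , _ , refl) =
    i , 0 , sym (trans (cong (a ℕ.* i ℕ.+_) (ℕ.*-zeroʳ b)) (ℕ.+-identityʳ _))

  -- From a i = a x + b (y + 1) with i < b, the divisor b of a (i - x) divides i - x ≤ i.
  Apéry⇒¬shift : gcd a b ≡ 1 → ∀ {n} → Representable a b n → ¬ (b ℕ.+ n) ∈Apéry
  Apéry⇒¬shift gcd≡1 (x , y , refl) (i , i<b , eq) =
    ℕ.<⇒≱ i<b (ℕ.≤-trans (∣⇒≤ {{ℕ.>-nonZero (ℕ.m<n⇒0<n∸m x<i)}} b∣i∸x) (ℕ.m∸n≤m i x))
    where
    open ≡-Reasoning

    ax+b[1+y]≡ai : a ℕ.* x ℕ.+ b ℕ.* suc y ≡ a ℕ.* i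
    ax+b[1+y]≡ai = trans
      (solve 4 (λ a b x y → a :* x :+ b :* (con 1 :+ y) := b :+ (a :* x :+ b :* y)) refl a b x y) eq

    x<i : x ℕ.< i
    x<i = ℕ.*-cancelˡ-< a x i (subst (a ℕ.* x ℕ.<_) ax+b[1+y]≡ai
      (ℕ.m<m+n (a ℕ.* x) (ℕ.>-nonZero⁻¹ (b ℕ.* suc y) {{ℕ.m*n≢0 b (suc y)}})))

    b∣i∸x : b ∣ i ∸ x
    b∣i∸x = coprime-divisor (Coprimality.sym (gcd≡1⇒coprime {a} {b} gcd≡1)) (divides (suc y) (begin
      a ℕ.* (i ∸ x)                           ≡⟨ ℕ.*-distribˡ-∸ a i x ⟩
      a ℕ.* i ∸ a ℕ.* x                       ≡⟨ cong (_∸ a ℕ.* x) ax+b[1+y]≡ai ⟨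
      a ℕ.* x ℕ.+ b ℕ.* suc y ∸ a ℕ.* x       ≡⟨ ℕ.m+n∸m≡n (a ℕ.* x) (b ℕ.* suc y) ⟩
      b ℕ.* suc y                             ≡⟨ ℕ.*-comm b (suc y) ⟩
      suc y ℕ.* b                             ∎))

  -- Both lists enumerate, without repetition, the `n` that are not of the form `b + m` with `m`
  -- representable. For duplicate-free lists, having the same members suffices for a permutation.
  NR-shift-↭ : gcd a b ≡ 1 → (A : Finite (NR a b)) → let open Finite A in
    map (b ℕ.+_) elements ++ upTo b ↭ elements ++ map (a ℕ.*_) (upTo b)
  NR-shift-↭ gcd≡1 A = ∼bag⇒↭ (unique∧set⇒bag
    (Unique.++⁺ (Unique.map⁺ (ℕ.+-cancelˡ-≡ b _ _) unique) (Unique.upTo⁺ b) shift-disjoint)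
    (Unique.++⁺ unique (Unique.map⁺ (ℕ.*-cancelˡ-≡ _ _ a) (Unique.upTo⁺ b)) Apéry-disjoint)
    (mk⇔ to from))
    where
    open Finite A

    NR⇒∈ : ∀ {n} → NR a b n → n ∈ elements
    NR⇒∈ = Equivalence.from (complete _)

    ∈⇒NR : ∀ {n} → n ∈ elements → NR a b n
    ∈⇒NR = Equivalence.to (complete _)

    ∈Apéry⁺ : ∀ {n} → n ∈Apéry → n ∈ map (a ℕ.*_) (upTo b)
    ∈Apéry⁺ (i , i<b , refl) = ∈-map⁺ (a ℕ.*_) (∈-upTo⁺ i<b)

    ∈Apéry⁻ : ∀ {n} → n ∈ map (a ℕ.*_) (upTo b) → n ∈Apéry
    ∈Apéry⁻ n∈ with ∈-map⁻ (a ℕ.*_) n∈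
    ... | i , i∈ , n≡ai = i , ∈-upTo⁻ i∈ , n≡ai

    shift-disjoint : ∀ {n} → ¬ (n ∈ map (b ℕ.+_) elements × n ∈ upTo b)
    shift-disjoint (n∈shift , n∈upTo) with ∈-map⁻ (b ℕ.+_) n∈shift
    ... | m , _ , refl = ℕ.m+n≮m b m (∈-upTo⁻ n∈upTo)

    Apéry-disjoint : ∀ {n} → ¬ (n ∈ elements × n ∈ map (a ℕ.*_) (upTo b))
    Apéry-disjoint (n∈NR , n∈Ap) = ∈⇒NR n∈NR (Apéry⇒representable (∈Apéry⁻ n∈Ap))

    to : ∀ {n} → n ∈ map (b ℕ.+_) elements ++ upTo b → n ∈ elements ++ map (a ℕ.*_) (upTo b)
    to {n} n∈ with representable? a b n
    ... | no ¬rep = ∈-++⁺ˡ (NR⇒∈ ¬rep)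
    ... | yes rep with representable⇒shift⊎Apéry rep
    ...   | inj₂ n∈Ap = ∈-++⁺ʳ elements (∈Apéry⁺ n∈Ap)
    -- This case is impossible: `b + m` is not below `b`, and if it is a shifted element `b + k`
    -- then cancelling `b` makes the representable `m` equal to the nonrepresentable `k`.
    ...   | inj₁ (m , rep-m , refl) with ∈-++⁻ (map (b ℕ.+_) elements) n∈
    ...     | inj₂ n∈upTo = contradiction (∈-upTo⁻ n∈upTo) (ℕ.m+n≮m b m)
    ...     | inj₁ n∈shift with ∈-map⁻ (b ℕ.+_) n∈shift
    ...       | k , k∈NR , b+m≡b+k =
      contradiction (subst (Representable a b) (ℕ.+-cancelˡ-≡ b m k b+m≡b+k) rep-m) (∈⇒NR k∈NR)

    -- Were `m` representable, `b + m` would be representable, hence not in `elements`, and a shift,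
    -- hence not in the Apéry set.
    from-≥ : ∀ m → b ℕ.+ m ∈ elements ++ map (a ℕ.*_) (upTo b) → NR a b m
    from-≥ m n∈ rep-m with ∈-++⁻ elements n∈
    ... | inj₁ n∈NR = ∈⇒NR n∈NR (representable-+ rep-m)
    ... | inj₂ n∈Ap = Apéry⇒¬shift gcd≡1 rep-m (∈Apéry⁻ n∈Ap)

    from : ∀ {n} → n ∈ elements ++ map (a ℕ.*_) (upTo b) → n ∈ map (b ℕ.+_) elements ++ upTo b
    from {n} n∈ with n ℕ.<? b
    ... | yes n<b = ∈-++⁺ʳ (map (b ℕ.+_) elements) (∈-upTo⁺ n<b)
    ... | no n≮b with ℕ.m≤n⇒∃[o]m+o≡n (ℕ.≮⇒≥ n≮b)
    ...   | m , refl = ∈-++⁺ˡ (∈-map⁺ (b ℕ.+_) (NR⇒∈ (from-≥ m n∈)))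

-- Finite sums in a commutative ring.

module RingSums (R : CommutativeRing ℓ₁ ℓ₂) where

  open CommutativeRing R renaming
    (refl to ≈-refl; sym to ≈-sym; trans to ≈-trans; zero to *-zero; setoid to ≈-setoid)
  open Exp semiring using (_^_; ^-homo-*; ^-assocʳ)
  open Mult semiring using (×-homo-+; ×1-homo-*) renaming (_×_ to _•_)
  open GroupProperties +-group using () renaming
    ( ∙-cancelʳ to +-cancelʳ; //-rightDividesˡ to [y-x]+x≈y; //-rightDividesʳ to [y+x]-x≈y)
  open NaturalCoefficients commutativeSemiring using (solve; _:+_; _:*_; _:^_; _:=_)
  open SetoidReasoning ≈-setoid

  fromNat : ℕ → Carrier
  fromNat n = n • 1#

  -- Of the same shape as `∑`, so that `S` unfolds to a `sumOver`.
  sumOver : {I : Set ℓ₃} → List I → (I → Carrier) → Carrier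
  sumOver is f = foldr _+_ 0# (map f is)

  module _ {I : Set ℓ₃} where

    sum-cong : ∀ (is : List I) {f g} → (∀ i → f i ≈ g i) → sumOver is f ≈ sumOver is g
    sum-cong []       f≈g = ≈-refl
    sum-cong (i ∷ is) f≈g = +-cong (f≈g i) (sum-cong is f≈g)

    sum-+ : ∀ (is : List I) f g → sumOver is (λ i → f i + g i) ≈ sumOver is f + sumOver is g
    sum-+ []       f g = ≈-sym (+-identityˡ 0#)
    sum-+ (i ∷ is) f g = ≈-trans (+-congˡ (sum-+ is f g))
      (solve 4 (λ x y u v → (x :+ y) :+ (u :+ v) := (x :+ u) :+ (y :+ v)) ≈-refl
        (f i) (g i) (sumOver is f) (sumOver is g))

    sum-*ˡ : ∀ (is : List I) c f → sumOver is (λ i → c * f i) ≈ c * sumOver is f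
    sum-*ˡ []       c f = ≈-sym (zeroʳ c)
    sum-*ˡ (i ∷ is) c f = ≈-trans (+-congˡ (sum-*ˡ is c f)) (≈-sym (distribˡ c (f i) (sumOver is f)))

    sum-++ : ∀ (is js : List I) f → sumOver (is ++ js) f ≈ sumOver is f + sumOver js f
    sum-++ []       js f = ≈-sym (+-identityˡ _)
    sum-++ (i ∷ is) js f = ≈-trans (+-congˡ (sum-++ is js f)) (≈-sym (+-assoc _ _ _))

    sum-map : ∀ {J : Set ℓ₃} (h : J → I) js f → sumOver (map h js) f ≈ sumOver js (f ∘ h)
    sum-map h js f = reflexive (cong (foldr _+_ 0#) (sym (List.map-∘ js)))

    sum-↭ : ∀ {is js : List I} f → is ↭ js → sumOver is f ≈ sumOver js f
    sum-↭ f is↭js = Permutation.foldr-commMonoid ≈-setoid +-isCommutativeMonoid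
      (Permutation.map⁺ (setoid I) ≈-setoid (reflexive ∘ cong f) (↭⇒↭ₛ is↭js))

  -- Stated with `g 0` added on the right instead of subtracted on the left, which keeps the
  -- identity within reach of the semiring solver.
  sum-telescope : ∀ (f g : ℕ → Carrier) → (∀ i → g (suc i) ≈ f i + g i) →
                  ∀ k → g k ≈ sumOver (upTo k) f + g 0
  sum-telescope f g step zero    = ≈-sym (+-identityˡ (g 0))
  sum-telescope f g step (suc k) = begin
    g (suc k)                              ≈⟨ step k ⟩
    f k + g k                              ≈⟨ +-congˡ (sum-telescope f g step k) ⟩
    f k + (sumOver (upTo k) f + g 0)       ≈⟨ solve 3 (λ x y z → x :+ (y :+ z) := (y :+ x) :+ z)
                                                ≈-refl (f k) (sumOver (upTo k) f) (g 0) ⟩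
    (sumOver (upTo k) f + f k) + g 0       ≈⟨ +-congʳ (+-congˡ (+-identityʳ (f k))) ⟨
    (sumOver (upTo k) f + sumOver [ k ] f) + g 0
                                           ≈⟨ +-congʳ (sum-++ (upTo k) [ k ] f) ⟨
    sumOver (upTo k ++ [ k ]) f + g 0      ≡⟨ cong (λ is → sumOver is f + g 0) (List.upTo-∷ʳ k) ⟩
    sumOver (upTo (suc k)) f + g 0         ∎

  -- To the semiring solver `x - 1#` is an atom, so `x` has to be expressed through it beforehand.
  x≈[x-1]+1 : ∀ x → x ≈ (x - 1#) + 1#
  x≈[x-1]+1 x = ≈-sym ([y-x]+x≈y 1# x)

  x^n≈x*x^[n∸1] : ∀ x n .{{_ : NonZero n}} → x ^ n ≈ x * x ^ (n ∸ 1)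
  x^n≈x*x^[n∸1] x n = reflexive (cong (x ^_) (sym (ℕ.suc-pred n)))

  -- Brings the bracket in the third term of the formula into the form `α * A * r + β * B * q` in
  -- which `eliminate` delivers it.
  numerator : ∀ x a b → let α = fromNat a; β = fromNat b in
    fromNat (a ℕ.+ b) * x ^ (a ℕ.+ b) - α * x ^ a - β * x ^ b
      ≈ α * x ^ a * (x ^ b - 1#) + β * x ^ b * (x ^ a - 1#)
  numerator x a b = begin
    fromNat (a ℕ.+ b) * x ^ (a ℕ.+ b) - α * A - β * B
      ≈⟨ +-congʳ (+-congʳ (*-cong (×-homo-+ 1# a b) (^-homo-* x a b))) ⟩
    (α + β) * (A * B) - α * A - β * B
      ≈⟨ +-congʳ (+-congʳ (solve 4 (λ α β A B →
           (α :+ β) :* (A :* B) := α :* A :* B :+ β :* B :* A) ≈-refl α β A B)) ⟩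
    (α * A * B + β * B * A) - α * A - β * B
      ≈⟨ +-congʳ (+-congʳ (+-cong (expand (α * A) B) (expand (β * B) A))) ⟩
    ((α * A * (B - 1#) + α * A) + (β * B * (A - 1#) + β * B)) - α * A - β * B
      ≈⟨ +-congʳ (+-congʳ (solve 4 (λ u v w z → (u :+ v) :+ (w :+ z) := ((u :+ w) :+ z) :+ v)
           ≈-refl (α * A * (B - 1#)) (α * A) (β * B * (A - 1#)) (β * B))) ⟩
    (((α * A * (B - 1#) + β * B * (A - 1#)) + β * B) + α * A) - α * A - β * B
      ≈⟨ +-congʳ ([y+x]-x≈y (α * A) _) ⟩
    ((α * A * (B - 1#) + β * B * (A - 1#)) + β * B) - β * B
      ≈⟨ [y+x]-x≈y (β * B) _ ⟩
    α * A * (B - 1#) + β * B * (A - 1#) ∎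
    where
    α = fromNat a
    β = fromNat b
    A = x ^ a
    B = x ^ b
    expand : ∀ y z → y * z ≈ y * (z - 1#) + y
    expand y z = begin
      y * z                   ≈⟨ *-congˡ (x≈[x-1]+1 z) ⟩
      y * ((z - 1#) + 1#)     ≈⟨ distribˡ y (z - 1#) 1# ⟩
      y * (z - 1#) + y * 1#   ≈⟨ +-congˡ (*-identityʳ y) ⟩
      y * (z - 1#) + y        ∎

  -- Closed forms of geometric and arithmetico-geometric sums.

  geometric : Carrier → ℕ → Carrier
  geometric x k = sumOver (upTo k) (x ^_)

  arithmeticoGeometric : Carrier → ℕ → Carrier
  arithmeticoGeometric x k = sumOver (upTo k) λ i → fromNat i * x ^ i

  -- Telescoping of `x ^ i`, whose forward difference is `(x - 1#) * x ^ i`. The multiplied-out form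
  -- makes sense in every commutative ring.
  geometric-closed : ∀ x k → x ^ k - 1# ≈ (x - 1#) * geometric x k
  geometric-closed x k = +-cancelʳ 1# _ _ (begin
    (x ^ k - 1#) + 1#                                ≈⟨ x≈[x-1]+1 (x ^ k) ⟨
    x ^ k                                            ≈⟨ sum-telescope _ (x ^_) step k ⟩
    sumOver (upTo k) (λ i → (x - 1#) * x ^ i) + 1#   ≈⟨ +-congʳ (sum-*ˡ (upTo k) (x - 1#) (x ^_)) ⟩
    (x - 1#) * geometric x k + 1#                    ∎)
    where
    step : ∀ i → x ^ suc i ≈ (x - 1#) * x ^ i + x ^ i
    step i = begin
      x * x ^ i                      ≈⟨ *-congʳ (x≈[x-1]+1 x) ⟩
      ((x - 1#) + 1#) * x ^ i        ≈⟨ distribʳ (x ^ i) (x - 1#) 1# ⟩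
      (x - 1#) * x ^ i + 1# * x ^ i  ≈⟨ +-congˡ (*-identityˡ (x ^ i)) ⟩
      (x - 1#) * x ^ i + x ^ i       ∎

  -- Telescoping of `fromNat i * x ^ i`: its forward difference is `x - 1#` times itself plus
  -- `x * x ^ i`, and the latter sums to a geometric sum.
  arithmeticoGeometric-closed : ∀ x k →
    fromNat k * x ^ k ≈ (x - 1#) * arithmeticoGeometric x k + x * geometric x k
  arithmeticoGeometric-closed x k = begin
    fromNat k * x ^ k
      ≈⟨ sum-telescope _ (λ i → fromNat i * x ^ i) step k ⟩
    -- The final `0# * 1#` is the initial value `fromNat 0 * x ^ 0`.
    sumOver (upTo k) (λ i → (x - 1#) * (fromNat i * x ^ i) + x * x ^ i) + 0# * 1#
      ≈⟨ +-cong (sum-+ (upTo k) _ _) (zeroˡ 1#) ⟩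
    (sumOver (upTo k) (λ i → (x - 1#) * (fromNat i * x ^ i)) + sumOver (upTo k) (λ i → x * x ^ i)) + 0#
      ≈⟨ +-identityʳ _ ⟩
    sumOver (upTo k) (λ i → (x - 1#) * (fromNat i * x ^ i)) + sumOver (upTo k) (λ i → x * x ^ i)
      ≈⟨ +-cong (sum-*ˡ (upTo k) (x - 1#) _) (sum-*ˡ (upTo k) x (x ^_)) ⟩
    (x - 1#) * arithmeticoGeometric x k + x * geometric x k ∎
    where
    step : ∀ i → fromNat (suc i) * x ^ suc i
                   ≈ ((x - 1#) * (fromNat i * x ^ i) + x * x ^ i) + fromNat i * x ^ i
    step i = begin
      (1# + n) * (x * y)                        ≈⟨ distribʳ (x * y) 1# n ⟩
      1# * (x * y) + n * (x * y)                ≈⟨ +-cong (*-identityˡ (x * y)) (*-congˡ (*-congʳ (x≈[x-1]+1 x))) ⟩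
      x * y + n * (((x - 1#) + 1#) * y)         ≈⟨ solve 5 (λ x n p o y → x :* y :+ n :* ((p :+ o) :* y)
                                                     := (p :* (n :* y) :+ x :* y) :+ n :* (o :* y))
                                                     ≈-refl x n (x - 1#) 1# y ⟩
      ((x - 1#) * (n * y) + x * y) + n * (1# * y)  ≈⟨ +-congˡ (*-congˡ (*-identityˡ y)) ⟩
      ((x - 1#) * (n * y) + x * y) + n * y      ∎
      where
      n = fromNat i
      y = x ^ i

  -- The factor `x` restores the exponent lowered by one in the summands of `S` for `m = 1`.
  sum-weighted-powers : ∀ x (ns : List ℕ) → sumOver ns (λ n → fromNat n * x ^ n)
                          ≈ x * sumOver ns (λ n → x ^ (n ∸ 1) * fromNat n ^ 1)
  sum-weighted-powers x ns = ≈-trans (sum-cong ns term) (sum-*ˡ ns x _)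
    where
    term : ∀ n → fromNat n * x ^ n ≈ x * (x ^ (n ∸ 1) * fromNat n ^ 1)
    -- Here `0 ∸ 1` is truncated to `0`, harmlessly: the factor `fromNat 0` makes both sides vanish.
    term zero = begin
      0# * 1#                ≈⟨ *-comm 0# 1# ⟩
      1# * 0#                ≈⟨ *-identityˡ 0# ⟩
      0#                     ≈⟨ zeroʳ (x * 1#) ⟨
      x * 1# * 0#            ≈⟨ *-congˡ (zeroˡ 1#) ⟨
      x * 1# * (0# * 1#)     ≈⟨ *-assoc x 1# (0# * 1#) ⟩
      x * (1# * (0# * 1#))   ∎
    term (suc n) = begin
      fromNat (suc n) * (x * x ^ n)      ≈⟨ solve 3 (λ ν x y → ν :* (x :* y) := x :* (y :* ν))
                                              ≈-refl (fromNat (suc n)) x (x ^ n) ⟩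
      x * (x ^ n * fromNat (suc n))      ≈⟨ *-congˡ (*-congˡ (*-identityʳ (fromNat (suc n)))) ⟨
      x * (x ^ n * fromNat (suc n) ^ 1)  ∎

  -- Elimination of the auxiliary sums, and division by the common denominator.

  -- Eliminates T₀ = ∑_NR ƛⁿ and the telescoping sums ∑ ƛⁱ, ∑ ƛᵃⁱ, ∑ i ƛⁱ and ∑ i ƛᵃⁱ (i < b),
  -- called Gᴸ, Gᴬ, Hᴸ and Hᴬ, from the equation for T₁ = ∑_NR n ƛⁿ.
  -- Terms are moved so that no subtraction occurs, whence the cancelled term p q² r β B.
  eliminate : ∀ {p q r s L A B C α β T₀ T₁ Gᴸ Gᴬ Hᴸ Hᴬ} →
    r * T₀ + Gᴸ ≈ Gᴬ →
    r * T₁ + β * B * T₀ + Hᴸ ≈ α * Hᴬ →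
    r ≈ p * Gᴸ → s ≈ q * Gᴬ →
    β * B ≈ p * Hᴸ + L * Gᴸ → β * C ≈ q * Hᴬ + A * Gᴬ →
    (p * q * r) ^ 2 * T₁ + p ^ 2 * (s * (α * A * r + β * B * q))
      ≈ L * (q * r) ^ 2 + p ^ 2 * (q * r) * (α * β * C)
  eliminate {p} {q} {r} {s} {L} {A} {B} {C} {α} {β} {T₀} {T₁} {Gᴸ} {Gᴬ} {Hᴸ} {Hᴬ}
    T₀-eq T₁-eq Gᴸ-eq Gᴬ-eq Hᴸ-eq Hᴬ-eq = +-cancelʳ (p * q ^ 2 * r * (β * B)) _ _ (begin
      ((p * q * r) ^ 2 * T₁ + p ^ 2 * (s * (α * A * r + β * B * q))) + p * q ^ 2 * r * (β * B)
        -- Exposes the products `r * T₁`, `p * s` and `p * (β * B)`, which the equations can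
        -- replace.
        ≈⟨ solve 9 (λ p q r s A B α β T₁ →
             ((p :* q :* r) :^ 2 :* T₁ :+ p :^ 2 :* (s :* (α :* A :* r :+ β :* B :* q))) :+ p :* q :^ 2 :* r :* (β :* B)
             := p :^ 2 :* q :^ 2 :* r :* (r :* T₁) :+ α :* p :^ 2 :* r :* (A :* s)
                :+ p :* q :* (β :* B) :* (p :* s) :+ q :^ 2 :* r :* (p :* (β :* B)))
             ≈-refl p q r s A B α β T₁ ⟩
      p ^ 2 * q ^ 2 * r * (r * T₁) + α * p ^ 2 * r * (A * s)
        + p * q * (β * B) * (p * s) + q ^ 2 * r * (p * (β * B))
        ≈⟨ +-cong (+-congˡ (*-congˡ ps-eq)) (*-congˡ pβB-eq) ⟩
      p ^ 2 * q ^ 2 * r * (r * T₁) + α * p ^ 2 * r * (A * s)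
        + p * q * (β * B) * (p * q * r * T₀ + q * r) + q ^ 2 * r * (p ^ 2 * Hᴸ + L * r)
        -- `T₁`, `T₀` and `Hᴸ` now share the factor `p ^ 2 * q ^ 2 * r` and assemble to the
        -- left-hand side of `T₁-eq`.
        ≈⟨ solve 11 (λ p q r A s L βB α T₀ T₁ Hᴸ →
             p :^ 2 :* q :^ 2 :* r :* (r :* T₁) :+ α :* p :^ 2 :* r :* (A :* s)
               :+ p :* q :* βB :* (p :* q :* r :* T₀ :+ q :* r) :+ q :^ 2 :* r :* (p :^ 2 :* Hᴸ :+ L :* r)
             := p :^ 2 :* q :^ 2 :* r :* (r :* T₁ :+ βB :* T₀ :+ Hᴸ)
                :+ (α :* p :^ 2 :* r :* (A :* s) :+ p :* q :^ 2 :* r :* βB :+ L :* (q :* r) :^ 2))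
             ≈-refl p q r A s L (β * B) α T₀ T₁ Hᴸ ⟩
      p ^ 2 * q ^ 2 * r * (r * T₁ + β * B * T₀ + Hᴸ)
        + (α * p ^ 2 * r * (A * s) + p * q ^ 2 * r * (β * B) + L * (q * r) ^ 2)
        ≈⟨ +-congʳ (*-congˡ T₁-eq) ⟩
      p ^ 2 * q ^ 2 * r * (α * Hᴬ)
        + (α * p ^ 2 * r * (A * s) + p * q ^ 2 * r * (β * B) + L * (q * r) ^ 2)
        ≈⟨ solve 9 (λ p q r A s L βB α Hᴬ →
             p :^ 2 :* q :^ 2 :* r :* (α :* Hᴬ)
               :+ (α :* p :^ 2 :* r :* (A :* s) :+ p :* q :^ 2 :* r :* βB :+ L :* (q :* r) :^ 2)
             := α :* p :^ 2 :* r :* (q :^ 2 :* Hᴬ :+ A :* s) :+ p :* q :^ 2 :* r :* βB :+ L :* (q :* r) :^ 2)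
             ≈-refl p q r A s L (β * B) α Hᴬ ⟩
      α * p ^ 2 * r * (q ^ 2 * Hᴬ + A * s) + p * q ^ 2 * r * (β * B) + L * (q * r) ^ 2
        ≈⟨ +-congʳ (+-congʳ (*-congˡ qβC-eq)) ⟨
      α * p ^ 2 * r * (q * (β * C)) + p * q ^ 2 * r * (β * B) + L * (q * r) ^ 2
        ≈⟨ solve 8 (λ p q r L βB α β C →
             α :* p :^ 2 :* r :* (q :* (β :* C)) :+ p :* q :^ 2 :* r :* βB :+ L :* (q :* r) :^ 2
             := (L :* (q :* r) :^ 2 :+ p :^ 2 :* (q :* r) :* (α :* β :* C)) :+ p :* q :^ 2 :* r :* βB)
             ≈-refl p q r L (β * B) α β C ⟩
      (L * (q * r) ^ 2 + p ^ 2 * (q * r) * (α * β * C)) + p * q ^ 2 * r * (β * B) ∎)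
    where
    -- The factor `q` of `s` multiplies `Gᴬ`, which `T₀-eq` trades for `T₀` and `Gᴸ`; the factor `p`
    -- then turns `Gᴸ` into `r`, so no geometric sum is left.
    ps-eq : p * s ≈ p * q * r * T₀ + q * r
    ps-eq = begin
      p * s                          ≈⟨ *-congˡ (≈-trans Gᴬ-eq (*-congˡ (≈-sym T₀-eq))) ⟩
      p * (q * (r * T₀ + Gᴸ))        ≈⟨ solve 5 (λ p q r T₀ Gᴸ → p :* (q :* (r :* T₀ :+ Gᴸ))
                                          := p :* q :* r :* T₀ :+ q :* (p :* Gᴸ)) ≈-refl p q r T₀ Gᴸ ⟩
      p * q * r * T₀ + q * (p * Gᴸ)  ≈⟨ +-congˡ (*-congˡ Gᴸ-eq) ⟨
      p * q * r * T₀ + q * r         ∎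

    -- The extra factor `x` completes the geometric sum `m` to `x * m`, which is replaced by `r` or
    -- `s` below.
    scale : ∀ {x y z w m} → w ≈ x * y + z * m → x * w ≈ x ^ 2 * y + z * (x * m)
    scale {x} {y} {z} {w} {m} w≈ = ≈-trans (*-congˡ w≈)
      (solve 4 (λ x y z m → x :* (x :* y :+ z :* m) := x :^ 2 :* y :+ z :* (x :* m)) ≈-refl x y z m)

    pβB-eq : p * (β * B) ≈ p ^ 2 * Hᴸ + L * r
    pβB-eq = ≈-trans (scale Hᴸ-eq) (+-congˡ (*-congˡ (≈-sym Gᴸ-eq)))

    qβC-eq : q * (β * C) ≈ q ^ 2 * Hᴬ + A * s
    qβC-eq = ≈-trans (scale Hᴬ-eq) (+-congˡ (*-congˡ (≈-sym Gᴬ-eq)))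

  -- `X`, `Y` and `Z` are the three fractions of the formula, known only through their products with
  -- their denominators. `D` is the product of the denominators of `X` and `Z`, and that of `Y`
  -- divides it. With `Z` moved to the left, both sides agree after multiplication by `D`, which has
  -- inverse `u`.
  divide : ∀ {p q r s L C C′ α β U V S X Y Z u} →
    (p * q * r) ^ 2 * (L * S) + p ^ 2 * (s * U) ≈ L * (q * r) ^ 2 + p ^ 2 * (q * r) * (α * β * C) →
    C ≈ L * C′ → V ≈ U →
    p ^ 2 * X ≈ 1# → q * r * Y ≈ α * β * C′ → L * q ^ 2 * r ^ 2 * Z ≈ s * V →
    p ^ 2 * (L * q ^ 2 * r ^ 2) * u ≈ 1# →
    S ≈ X + Y - Z
  divide {p} {q} {r} {s} {L} {C} {C′} {α} {β} {U} {V} {S} {X} {Y} {Z} {u}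
    S-eq C≈LC′ V≈U X-eq Y-eq Z-eq Du≈1 = begin
      S              ≈⟨ [y+x]-x≈y Z S ⟨
      S + Z - Z      ≈⟨ +-congʳ (cancel (S + Z) (X + Y) D[S+Z]≈D[X+Y]) ⟩
      X + Y - Z      ∎
    where
    D = p ^ 2 * (L * q ^ 2 * r ^ 2)

    cancel : ∀ x y → D * x ≈ D * y → x ≈ y
    cancel x y Dx≈Dy = begin
      x            ≈⟨ *-identityˡ x ⟨
      1# * x       ≈⟨ *-congʳ Du≈1 ⟨
      D * u * x    ≈⟨ solve 3 (λ d u x → d :* u :* x := u :* (d :* x)) ≈-refl D u x ⟩
      u * (D * x)  ≈⟨ *-congˡ Dx≈Dy ⟩
      u * (D * y)  ≈⟨ solve 3 (λ d u y → u :* (d :* y) := d :* u :* y) ≈-refl D u y ⟩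
      D * u * y    ≈⟨ *-congʳ Du≈1 ⟩
      1# * y       ≈⟨ *-identityˡ y ⟩
      y            ∎

    D[S+Z]≈D[X+Y] : D * (S + Z) ≈ D * (X + Y)
    D[S+Z]≈D[X+Y] = begin
      p ^ 2 * (L * q ^ 2 * r ^ 2) * (S + Z)
        ≈⟨ solve 6 (λ p q r L S Z → p :^ 2 :* (L :* q :^ 2 :* r :^ 2) :* (S :+ Z)
             := (p :* q :* r) :^ 2 :* (L :* S) :+ p :^ 2 :* (L :* q :^ 2 :* r :^ 2 :* Z))
             ≈-refl p q r L S Z ⟩
      (p * q * r) ^ 2 * (L * S) + p ^ 2 * (L * q ^ 2 * r ^ 2 * Z)
        ≈⟨ +-congˡ (*-congˡ (≈-trans Z-eq (*-congˡ V≈U))) ⟩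
      (p * q * r) ^ 2 * (L * S) + p ^ 2 * (s * U)
        ≈⟨ S-eq ⟩
      L * (q * r) ^ 2 + p ^ 2 * (q * r) * (α * β * C)
        ≈⟨ +-cong (≈-trans (≈-sym (*-identityʳ _)) (*-congˡ (≈-sym X-eq))) (*-congˡ (*-congˡ C≈LC′)) ⟩
      L * (q * r) ^ 2 * (p ^ 2 * X) + p ^ 2 * (q * r) * (α * β * (L * C′))
        ≈⟨ solve 8 (λ p q r L X α β C′ →
             L :* (q :* r) :^ 2 :* (p :^ 2 :* X) :+ p :^ 2 :* (q :* r) :* (α :* β :* (L :* C′))
             := p :^ 2 :* (L :* q :^ 2 :* r :^ 2) :* X :+ p :^ 2 :* (q :* r) :* (L :* (α :* β :* C′)))
             ≈-refl p q r L X α β C′ ⟩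
      p ^ 2 * (L * q ^ 2 * r ^ 2) * X + p ^ 2 * (q * r) * (L * (α * β * C′))
        ≈⟨ +-congˡ (*-congˡ (*-congˡ Y-eq)) ⟨
      p ^ 2 * (L * q ^ 2 * r ^ 2) * X + p ^ 2 * (q * r) * (L * (q * r * Y))
        ≈⟨ solve 6 (λ p q r L X Y →
             p :^ 2 :* (L :* q :^ 2 :* r :^ 2) :* X :+ p :^ 2 :* (q :* r) :* (L :* (q :* r :* Y))
             := p :^ 2 :* (L :* q :^ 2 :* r :^ 2) :* (X :+ Y)) ≈-refl p q r L X Y ⟩
      p ^ 2 * (L * q ^ 2 * r ^ 2) * (X + Y) ∎

  -- Power sums over the nonrepresentable numbers.

  module _ (a b : ℕ) .{{_ : NonZero a}} .{{_ : NonZero b}} (gcd≡1 : gcd a b ≡ 1)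
           (N : Finite (NR a b)) (x : Carrier) where

    open Finite N using (elements)

    private
      α = fromNat a
      β = fromNat b
      p = x - 1#
      A = x ^ a
      B = x ^ b
      C = x ^ (a ℕ.* b)
      q = A - 1#
      r = B - 1#
      s = C - 1#
      T₀ = sumOver elements (x ^_)
      T₁ = sumOver elements λ n → fromNat n * x ^ n

    NR-shift : ∀ f → sumOver elements (λ n → f (b ℕ.+ n)) + sumOver (upTo b) f
                   ≈ sumOver elements f + sumOver (upTo b) (λ i → f (a ℕ.* i))
    NR-shift f = begin
      sumOver elements (λ n → f (b ℕ.+ n)) + sumOver (upTo b) f
        ≈⟨ +-congʳ (sum-map (b ℕ.+_) elements f) ⟨
      sumOver (map (b ℕ.+_) elements) f + sumOver (upTo b) f
        ≈⟨ sum-++ (map (b ℕ.+_) elements) (upTo b) f ⟨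
      sumOver (map (b ℕ.+_) elements ++ upTo b) f
        ≈⟨ sum-↭ f (NR-shift-↭ a b gcd≡1 N) ⟩
      sumOver (elements ++ map (a ℕ.*_) (upTo b)) f
        ≈⟨ sum-++ elements (map (a ℕ.*_) (upTo b)) f ⟩
      sumOver elements f + sumOver (map (a ℕ.*_) (upTo b)) f
        ≈⟨ +-congˡ (sum-map (a ℕ.*_) (upTo b) f) ⟩
      sumOver elements f + sumOver (upTo b) (λ i → f (a ℕ.* i)) ∎

    private
      -- Shifting by `b` multiplies the unknown sum `t` by `B`; cancelling one `t` leaves the
      -- coefficient `B - 1#`, that is `r`. The term `w` has room for the lower-order contribution
      -- of a weighted sum.
      subtract : ∀ {t w y z} → (B * t + w) + y ≈ t + z → (r * t + w) + y ≈ z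
      subtract {t} {w} {y} {z} eq = +-cancelʳ t _ _ (begin
        ((r * t + w) + y) + t      ≈⟨ +-congˡ (*-identityˡ t) ⟨
        ((r * t + w) + y) + 1# * t ≈⟨ solve 5 (λ r t w y o → ((r :* t :+ w) :+ y) :+ o :* t
                                        := ((r :+ o) :* t :+ w) :+ y) ≈-refl r t w y 1# ⟩
        ((r + 1#) * t + w) + y     ≈⟨ +-congʳ (+-congʳ (*-congʳ (x≈[x-1]+1 B))) ⟨
        (B * t + w) + y            ≈⟨ eq ⟩
        t + z                      ≈⟨ +-comm t z ⟩
        z + t                      ∎)

    NR-power-sum : r * T₀ + geometric x b ≈ geometric A b
    -- Without weights there is no lower-order contribution, so `w` is `0#`.
    NR-power-sum = ≈-trans (+-congʳ (≈-sym (+-identityʳ _))) (subtract (begin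
      (B * T₀ + 0#) + geometric x b
        ≈⟨ +-congʳ (+-identityʳ (B * T₀)) ⟩
      B * T₀ + geometric x b
        ≈⟨ +-congʳ (sum-*ˡ elements B (x ^_)) ⟨
      sumOver elements (λ n → B * x ^ n) + geometric x b
        ≈⟨ +-congʳ (sum-cong elements (^-homo-* x b)) ⟨
      sumOver elements (λ n → x ^ (b ℕ.+ n)) + geometric x b
        ≈⟨ NR-shift (x ^_) ⟩
      T₀ + sumOver (upTo b) (λ i → x ^ (a ℕ.* i))
        ≈⟨ +-congˡ (sum-cong (upTo b) (^-assocʳ x a)) ⟨
      T₀ + geometric A b ∎))

    -- The weight `b + n` splits, and its part `b` brings in `T₀`; on the Apéry set the weight
    -- `a * i` releases the factor `α` and leaves a sum with ratio `A`.
    NR-weighted-power-sum :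
      r * T₁ + β * B * T₀ + arithmeticoGeometric x b ≈ α * arithmeticoGeometric A b
    NR-weighted-power-sum = subtract (begin
      (B * T₁ + β * B * T₀) + arithmeticoGeometric x b
        ≈⟨ +-congʳ (+-cong (sum-*ˡ elements B _) (sum-*ˡ elements (β * B) (x ^_))) ⟨
      (sumOver elements (λ n → B * (fromNat n * x ^ n)) + sumOver elements (λ n → β * B * x ^ n))
        + arithmeticoGeometric x b
        ≈⟨ +-congʳ (sum-+ elements _ _) ⟨
      sumOver elements (λ n → B * (fromNat n * x ^ n) + β * B * x ^ n) + arithmeticoGeometric x b
        ≈⟨ +-congʳ (sum-cong elements term-+) ⟨
      sumOver elements (λ n → fromNat (b ℕ.+ n) * x ^ (b ℕ.+ n)) + arithmeticoGeometric x b
        ≈⟨ NR-shift (λ n → fromNat n * x ^ n) ⟩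
      T₁ + sumOver (upTo b) (λ i → fromNat (a ℕ.* i) * x ^ (a ℕ.* i))
        ≈⟨ +-congˡ (sum-cong (upTo b) term-*) ⟩
      T₁ + sumOver (upTo b) (λ i → α * (fromNat i * A ^ i))
        ≈⟨ +-congˡ (sum-*ˡ (upTo b) α _) ⟩
      T₁ + α * arithmeticoGeometric A b ∎)
      where
      term-+ : ∀ n → fromNat (b ℕ.+ n) * x ^ (b ℕ.+ n) ≈ B * (fromNat n * x ^ n) + β * B * x ^ n
      term-+ n = ≈-trans (*-cong (×-homo-+ 1# b n) (^-homo-* x b n))
        (solve 4 (λ β ν B y → (β :+ ν) :* (B :* y) := B :* (ν :* y) :+ β :* B :* y)
          ≈-refl β (fromNat n) B (x ^ n))
      term-* : ∀ i → fromNat (a ℕ.* i) * x ^ (a ℕ.* i) ≈ α * (fromNat i * A ^ i)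
      term-* i = ≈-trans (*-cong (×1-homo-* a i) (≈-sym (^-assocʳ x a i))) (*-assoc _ _ _)

    NR-weighted-power-sum-closed :
      (p * q * r) ^ 2 * T₁ + p ^ 2 * (s * (α * A * r + β * B * q))
        ≈ x * (q * r) ^ 2 + p ^ 2 * (q * r) * (α * β * C)
    NR-weighted-power-sum-closed = eliminate NR-power-sum NR-weighted-power-sum
      (geometric-closed x b)
      -- The closed forms with ratio `A` involve `A ^ b`, which is `C`.
      (≈-trans (+-congʳ (≈-sym (^-assocʳ x a b))) (geometric-closed A b))
      (arithmeticoGeometric-closed x b)
      (≈-trans (*-congˡ (≈-sym (^-assocʳ x a b))) (arithmeticoGeometric-closed A b))

-- The formula over the complex numbers.

open import Defs

theorem1 : (a b : ℕ) .{{_ : NonZero a}} .{{_ : NonZero b}} (gcd≡1 : gcd a b ≡ 1)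
    (ƛ : ℂ) (ƛ#0 : ƛ # 0#) (ƛᵃ#1 : ƛ ^ a # 1#) (ƛᵇ#1 : ƛ ^ b # 1#) →
    let
      [ƛ-1]²#0 = x#0⇒x^n#0 2 (x#y⇒x-y#0 (x^n#1⇒x#1 a ƛᵃ#1))
      ƛᵃ-1#0 = x#y⇒x-y#0 ƛᵃ#1
      ƛᵇ-1#0 = x#y⇒x-y#0 ƛᵇ#1
      denominator#0 = x*y#0 (x*y#0 ƛ#0 (x#0⇒x^n#0 2 ƛᵃ-1#0)) (x#0⇒x^n#0 2 ƛᵇ-1#0)
    in
    S 1 ƛ a b gcd≡1
      ≈ 1# / (ƛ - 1#) ^ 2 ⟨ [ƛ-1]²#0 ⟩
        + fromℕ a * fromℕ b * ƛ ^ (a ℕ.* b ∸ 1)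
            / (ƛ ^ a - 1#) * (ƛ ^ b - 1#) ⟨ x*y#0 ƛᵃ-1#0 ƛᵇ-1#0 ⟩
        - (ƛ ^ (a ℕ.* b) - 1#) * (fromℕ (a ℕ.+ b) * ƛ ^ (a ℕ.+ b) - fromℕ a * ƛ ^ a - fromℕ b * ƛ ^ b)
            / ƛ * (ƛ ^ a - 1#) ^ 2 * (ƛ ^ b - 1#) ^ 2 ⟨ denominator#0 ⟩
theorem1 a b gcd≡1 ƛ ƛ#0 ƛᵃ#1 ƛᵇ#1 = divide
  -- `T₁` is replaced by `ƛ` times the sum `S`.
  (R.trans (R.+-congʳ (R.*-congˡ (R.sym (sum-weighted-powers ƛ (Finite.elements N)))))
    (NR-weighted-power-sum-closed a b gcd≡1 N ƛ))
  -- As `a * b` is nonzero, the exponent `a * b ∸ 1` is not truncated.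
  (x^n≈x*x^[n∸1] ƛ (a ℕ.* b) {{ℕ.m*n≢0 a b}})
  (numerator ƛ a b)
  (y*[x/y]≈x _ [ƛ-1]²#0)
  (y*[x/y]≈x _ (x*y#0 ƛᵃ-1#0 ƛᵇ-1#0))
  (y*[x/y]≈x _ denominator#0)
  -- The reciprocal of the common denominator serves as `u`.
  (y*[x/y]≈x 1# (x*y#0 [ƛ-1]²#0 denominator#0))
  where
  open HeytingFieldProperties ℂ-heytingField using (commutativeRing; y*[x/y]≈x)
  module R = CommutativeRing commutativeRing
  open RingSums commutativeRing
  N = NR-finite a b gcd≡1
  -- Apartness of `ƛ` from `1#` is inherited from that of `ƛ ^ a`.
  [ƛ-1]²#0 = x#0⇒x^n#0 2 (x#y⇒x-y#0 (x^n#1⇒x#1 a ƛᵃ#1))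
  ƛᵃ-1#0 = x#y⇒x-y#0 ƛᵃ#1
  ƛᵇ-1#0 = x#y⇒x-y#0 ƛᵇ#1
  denominator#0 = x*y#0 (x*y#0 ƛ#0 (x#0⇒x^n#0 2 ƛᵃ-1#0)) (x#0⇒x^n#0 2 ƛᵇ-1#0)
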